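{- Let $\mathcal{L}$ be a computable linear order of order-type $\omega$, and let $C\subseteq\mathbb{N}$ be a co-c.e. cohesive set. Then the finite condensation $c_F(\Pi_C\mathcal{L})$ of the cohesive power $\Pi_C\mathcal{L}$ has order-type $\mathbf{1}+\eta$.
   Context: A set $C\subseteq\mathbb{N}$ is cohesive if it is infinite and for every c.e. set $W$, either $C\setminus W$ or $C\cap W$ is finite; co-c.e. means $\mathbb{N}\setminus C$ is c.e. Write $X\subseteq^* Y$ if $X\setminus Y$ is finite. A computable linear order $\mathcal{L}=(L,\prec_{\mathcal{L}})$ has computable domain $L\subseteq\mathbb{N}$ and computable order. The cohesive power $\Pi_C\mathcal{L}$ has as elements the classes $[\varphi]$ of partial computable $\varphi\colon\mathbb{N}\to L$ with $C\subseteq^*\mathrm{dom}(\varphi)$ under the equivalence $\varphi=_C\psi$ iff $C\subseteq^*\{x:\varphi(x)\downarrow=\psi(x)\downarrow\}$, ordered by $[\varphi]\prec[\psi]$ iff $C\subseteq^*\{x:\varphi(x)\downarrow,\psi(x)\downarrow,\varphi(x)\prec_{\mathcal{L}}\psi(x)\}$. For a linear order $\mathcal{M}$ and an element $x$, $c_F(x)$ is the set of $y$ such that the closed interval between $x$ and $y$ is finite; these sets partition $\mathcal{M}$ into intervals, and the finite condensation $c_F(\mathcal{M})$ is the set of these intervals ordered by $I<J$ iff every element of $I$ is below every element of $J$. $\mathbf{1}$ is the one-point order and $\eta$ the order-type of the rationals. -}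

module Defs where

open import Level using (0ℓ)
open import Data.Nat using (ℕ; zero; suc; _<_)
open import Data.Fin using (Fin)
open import Data.Vec using (Vec; []; _∷_; lookup)
open import Data.Product using (Σ; ∃; _×_; _,_; proj₁)
open import Data.Sum using (_⊎_)
open import Data.Maybe using (Maybe; nothing; just)
open import Data.List using (List)
open import Data.List.Relation.Unary.Any using (Any)
open import Relation.Nullary using (¬_)
open import Relation.Binary.PropositionalEquality using (_≡_)
import Data.Rational as Q

data PR : ℕ → Set where
  zer  : ∀ {n} → PR n
  succ : PR 1
  proj : ∀ {n} → Fin n → PR n
  comp : ∀ {n m} → PR m → Vec (PR n) m → PR n
  prec : ∀ {n} → PR n → PR (suc (suc n)) → PR (suc n)
  mu   : ∀ {n} → PR (suc n) → PR n

mutual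
  data Eval : ∀ {n} → PR n → Vec ℕ n → ℕ → Set where
    ev-zer  : ∀ {n} {xs : Vec ℕ n} → Eval zer xs 0
    ev-suc  : ∀ {x} → Eval succ (x ∷ []) (suc x)
    ev-proj : ∀ {n} {i : Fin n} {xs : Vec ℕ n} → Eval (proj i) xs (lookup xs i)
    ev-comp : ∀ {n m} {f : PR m} {gs : Vec (PR n) m} {xs : Vec ℕ n} {ys : Vec ℕ m} {y} →
              EvalAll gs xs ys → Eval f ys y → Eval (comp f gs) xs y
    ev-prec0 : ∀ {n} {f : PR n} {g : PR (suc (suc n))} {xs : Vec ℕ n} {y} →
               Eval f xs y → Eval (prec f g) (0 ∷ xs) y
    ev-precS : ∀ {n} {f : PR n} {g : PR (suc (suc n))} {xs : Vec ℕ n} {k r y} →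
               Eval (prec f g) (k ∷ xs) r → Eval g (k ∷ r ∷ xs) y →
               Eval (prec f g) (suc k ∷ xs) y
    ev-mu   : ∀ {n} {f : PR (suc n)} {xs : Vec ℕ n} {y} →
              Eval f (y ∷ xs) 0 →
              (∀ k → k < y → Σ ℕ (λ v → Eval f (k ∷ xs) (suc v))) →
              Eval (mu f) xs y

  data EvalAll : ∀ {n m} → Vec (PR n) m → Vec ℕ n → Vec ℕ m → Set where
    []  : ∀ {n} {xs : Vec ℕ n} → EvalAll [] xs []
    _∷_ : ∀ {n m} {g : PR n} {gs : Vec (PR n) m} {xs : Vec ℕ n} {y} {ys : Vec ℕ m} →
          Eval g xs y → EvalAll gs xs ys → EvalAll (g ∷ gs) xs (y ∷ ys)

_⟦_⟧≡_ : PR 1 → ℕ → ℕ → Set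
e ⟦ x ⟧≡ y = Eval e (x ∷ []) y

W : PR 1 → ℕ → Set
W e x = ∃ λ y → e ⟦ x ⟧≡ y

Finite : (ℕ → Set) → Set
Finite A = ∃ λ n → ∀ x → A x → x < n

Infinite : (ℕ → Set) → Set
Infinite A = ¬ Finite A

_⊆*_ : (ℕ → Set) → (ℕ → Set) → Set
X ⊆* Y = Finite (λ x → X x × ¬ Y x)

IsCE : (ℕ → Set) → Set
IsCE A = Σ (PR 1) λ e → (∀ x → A x → W e x) × (∀ x → W e x → A x)

IsCoCE : (ℕ → Set) → Set
IsCoCE C = IsCE (λ x → ¬ C x)

Cohesive : (ℕ → Set) → Set
Cohesive C = Infinite C ×
  (∀ (e : PR 1) → Finite (λ x → C x × ¬ W e x) ⊎ Finite (λ x → C x × W e x))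

ComputableSet : (ℕ → Set) → Set
ComputableSet A = Σ (PR 1) λ e →
  ∀ x → (A x → Eval e (x ∷ []) 1) × (¬ A x → Eval e (x ∷ []) 0)

ComputableRel : (ℕ → ℕ → Set) → Set
ComputableRel R = Σ (PR 2) λ e →
  ∀ x y → (R x y → Eval e (x ∷ y ∷ []) 1) × (¬ R x y → Eval e (x ∷ y ∷ []) 0)

record CompLinOrder : Set₁ where
  field
    L       : ℕ → Set
    _≺_     : ℕ → ℕ → Set
    L-comp  : ComputableSet L
    ≺-comp  : ComputableRel _≺_
    irrefl  : ∀ x → L x → ¬ (x ≺ x)
    trans   : ∀ x y z → L x → L y → L z → x ≺ y → y ≺ z → x ≺ z
    trichot : ∀ x y → L x → L y → (x ≺ y) ⊎ (x ≡ y) ⊎ (y ≺ x)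

OrderTypeω : CompLinOrder → Set
OrderTypeω 𝓛 = Σ (Σ ℕ L → ℕ) λ f →
    (∀ a b → proj₁ a ≺ proj₁ b → f a < f b)
  × (∀ a b → f a < f b → proj₁ a ≺ proj₁ b)
  × (∀ a b → f a ≡ f b → proj₁ a ≡ proj₁ b)
  × (∀ n → ∃ λ a → f a ≡ n)
  where open CompLinOrder 𝓛

module CohesivePower (𝓛 : CompLinOrder) (C : ℕ → Set) where
  open CompLinOrder 𝓛

  record Elem : Set where
    field
      code  : PR 1
      into  : ∀ x y → code ⟦ x ⟧≡ y → L y
      cdom  : C ⊆* W code
  open Elem public

  _≈C_ : Elem → Elem → Set
  φ ≈C ψ = C ⊆* (λ x → ∃ λ v → (code φ ⟦ x ⟧≡ v) × (code ψ ⟦ x ⟧≡ v))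

  _≺C_ : Elem → Elem → Set
  φ ≺C ψ = C ⊆* (λ x → ∃ λ v → ∃ λ w →
                   (code φ ⟦ x ⟧≡ v) × (code ψ ⟦ x ⟧≡ w) × (v ≺ w))

-- Finite condensation of a linear order (M, ≈, <) given up to a setoid
-- equality ≈ (elements of the order are ≈-classes).

module Condensation {M : Set} (_≈_ : M → M → Set) (_<_ : M → M → Set) where

  _≤_ : M → M → Set
  x ≤ y = (x < y) ⊎ (x ≈ y)

  Between : M → M → M → Set
  Between x y z = ((x ≤ z) × (z ≤ y)) ⊎ ((y ≤ z) × (z ≤ x))

  FiniteSubset : (M → Set) → Set
  FiniteSubset P = Σ (List M) λ zs → ∀ z → P z → Any (z ≈_) zs

  _∈cF_ : M → M → Set
  y ∈cF x = FiniteSubset (Between x y)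

  _<cF_ : M → M → Set
  x <cF y = ∀ a b → a ∈cF x → b ∈cF y → a < b

data _<1η_ : Maybe Q.ℚ → Maybe Q.ℚ → Set where
  nothing<just : ∀ {q} → nothing <1η just q
  just<just    : ∀ {p q} → p Q.< q → just p <1η just q

-- c_F(M) has order type 1 + η: there is a map M → 1+η inducing an order
-- isomorphism from the set of condensation classes onto 1 + η.
CondensationHasType1+η : {M : Set} → (M → M → Set) → (M → M → Set) → Set
CondensationHasType1+η {M} _≈_ _<_ = Σ (M → Maybe Q.ℚ) λ f →
    (∀ x y → y ∈cF x → f x ≡ f y)
  × (∀ x y → f x ≡ f y → y ∈cF x)
  × (∀ x y → x <cF y → f x <1η f y)
  × (∀ x y → f x <1η f y → x <cF y)
  × (∀ q → ∃ λ x → f x ≡ q)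
  where open Condensation _≈_ _<_

{-# OPTIONS --safe #-}

-- Let ρ φ n be the position of φ(n) in 𝓛 ≅ ω.  Two elements of the power lie in the same condensation
-- class iff |ρ φ − ρ ψ| is bounded by a constant almost everywhere on C, so the task is to find elements
-- strictly between two classes, and above each class.  The number of elements of 𝓛 between φ(n) and ψ(n)
-- is only approximable from below, and a computable θ has to commit itself on n after finitely many
-- stages, to a point with some number k(n) of elements seen on either side.  What is needed is that k
-- tends to infinity along C while θ is defined almost everywhere on C.  This is where C being co-c.e. is
-- used: smaller numbers not yet enumerated into the complement of C may reserve values of k, which makes
-- each value occur finitely often on C; infinitely many n in C still find a free value, and cohesiveness
-- turns "infinitely many" into "almost all".  Hence the classes form a countable dense order with a
-- least and no greatest element, and Cantor's back-and-forth identifies it with 1 + η.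

module Submission where

open import Defs
open import Level using (0ℓ)
open import Axiom.ExcludedMiddle using (ExcludedMiddle)
open import Algebra.Properties.CommutativeSemigroup using (interchange)
open import Data.Nat using (ℕ; zero; suc; pred; _+_; _*_; _∸_; _⊔_; _≤_; _<_; z≤n; s≤s; s≤s⁻¹)
open import Data.Nat.Properties
open import Data.Integer using (ℤ; -[1+_]) renaming (+_ to +ℤ_)
import Data.Rational as ℚ
import Data.Rational.Properties as ℚ
open import Data.Fin using (Fin; zero; suc; toℕ)
open import Data.Fin.Properties using (toℕ-injective)
open import Data.Vec using (Vec; []; _∷_; head; tail; lookup; tabulate)
open import Data.Vec.Properties using (tabulate∘lookup)
open import Data.List using (List; []; _∷_; _++_)
open import Data.List.Membership.Propositional using (_∈_; find)
open import Data.List.Relation.Unary.Any using (Any; here; there)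
open import Data.List.Relation.Unary.Any.Properties using (++⁺ˡ; ++⁺ʳ)
open import Data.Maybe using (Maybe; nothing; just)
open import Data.Product using (Σ; ∃; _×_; _,_; proj₁; proj₂; uncurry)
open import Data.Sum using (_⊎_; inj₁; inj₂)
open import Data.Unit using (⊤; tt)
open import Data.Empty using (⊥-elim)
open import Function using (_∘_; id; flip; _⇔_; mk⇔; Equivalence)
open import Function.Properties.Equivalence using () renaming (sym to ⇔-sym)
open import Relation.Binary.Definitions using (tri<; tri≈; tri>)
open import Relation.Nullary using (¬_; Dec; yes; no)
open import Relation.Binary.PropositionalEquality using (_≡_; _≢_; refl; sym; trans; cong; cong₂; subst; subst₂)
open Equivalence using (to; from)

-- Properties of all large numbers

Eventually : (ℕ → Set) → Set
Eventually P = ∃ λ s₀ → ∀ s → s₀ ≤ s → P s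

always : ∀ {P} → (∀ s → P s) → Eventually P
always p = 0 , λ s _ → p s

eventually-≥ : ∀ n → Eventually (n ≤_)
eventually-≥ n = n , λ _ n≤s → n≤s

eventually-map : ∀ {P Q} → (∀ s → P s → Q s) → Eventually P → Eventually Q
eventually-map f (s₀ , p) = s₀ , λ s s₀≤s → f s (p s s₀≤s)

eventually-zip : ∀ {P Q} → Eventually P → Eventually Q → Eventually (λ s → P s × Q s)
eventually-zip (a , p) (b , q) = a ⊔ b , λ s le →
  p s (≤-trans (m≤m⊔n a b) le) , q s (≤-trans (m≤n⊔m a b) le)

-- Finitely many thresholds have a maximum.
eventually-∀< : ∀ {P : ℕ → ℕ → Set} b → (∀ k → k < b → Eventually (P k)) →
                Eventually (λ s → ∀ k → k < b → P k s)
eventually-∀< zero p = always λ _ _ ()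
eventually-∀< {P} (suc b) p =
  eventually-map join (eventually-zip (eventually-∀< b λ k k<b → p k (m≤n⇒m≤1+n k<b)) (p b ≤-refl))
  where
  join : ∀ s → (∀ k → k < b → P k s) × P b s → ∀ k → k < suc b → P k s
  join s (below , at) k k<1+b with m<1+n⇒m<n∨m≡n k<1+b
  ... | inj₁ k<b  = below k k<b
  ... | inj₂ refl = at

eventually-witness : ∀ {P} → Eventually P → ∃ P
eventually-witness (s₀ , p) = s₀ , p s₀ ≤-refl

-- Computable total functions

Computable : ∀ {n} → (Vec ℕ n → ℕ) → Set
Computable {n} f = Σ (PR n) λ c → ∀ xs → Eval c xs (f xs)

Computables : ∀ {n m} → (Vec ℕ n → Vec ℕ m) → Set
Computables {n} {m} f = Σ (Vec (PR n) m) λ cs → ∀ xs → EvalAll cs xs (f xs)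

abstract
  computable-ext : ∀ {n} {f g : Vec ℕ n → ℕ} → (∀ xs → f xs ≡ g xs) → Computable f → Computable g
  computable-ext f≗g (c , ev) = c , λ xs → subst (Eval c xs) (f≗g xs) (ev xs)

infixr 5 _∷ᶜ_
infixr 9 _∘ᶜ_ _∘ᶜˢ_

abstract
  []ᶜ : ∀ {n} → Computables {n} (λ _ → [])
  []ᶜ = [] , λ _ → []

  _∷ᶜ_ : ∀ {n m} {f : Vec ℕ n → ℕ} {g : Vec ℕ n → Vec ℕ m} →
         Computable f → Computables g → Computables (λ xs → f xs ∷ g xs)
  (c , ev) ∷ᶜ (cs , evs) = c ∷ cs , λ xs → ev xs ∷ evs xs

  _∘ᶜ_ : ∀ {n m} {f : Vec ℕ m → ℕ} {g : Vec ℕ n → Vec ℕ m} →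
         Computable f → Computables g → Computable (f ∘ g)
  _∘ᶜ_ {g = g} (c , ev) (cs , evs) = comp c cs , λ xs → ev-comp (evs xs) (ev (g xs))

  _∘ᶜˢ_ : ∀ {n m k} {f : Vec ℕ m → Vec ℕ k} {g : Vec ℕ n → Vec ℕ m} →
          Computables f → Computables g → Computables (f ∘ g)
  _∘ᶜˢ_ {n} {m} {g = g} (ds , evds) (cs , evs) = composites ds , λ xs → composites-eval (evds (g xs)) xs (evs xs)
    where
    composites : ∀ {k} → Vec (PR m) k → Vec (PR n) k
    composites []       = []
    composites (d ∷ ds) = comp d cs ∷ composites ds
    composites-eval : ∀ {k} {ds : Vec (PR m) k} {ys zs} → EvalAll ds ys zs →
                      ∀ xs → EvalAll cs xs ys → EvalAll (composites ds) xs zs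
    composites-eval []       xs e = []
    composites-eval (d ∷ ds) xs e = ev-comp e d ∷ composites-eval ds xs e

  projᶜ : ∀ {n} (i : Fin n) → Computable (λ xs → lookup xs i)
  projᶜ i = proj i , λ _ → ev-proj

  lookupsᶜ : ∀ {n m} (h : Fin m → Fin n) → Computables (λ xs → tabulate (λ i → lookup xs (h i)))
  lookupsᶜ {m = zero}  h = []ᶜ
  lookupsᶜ {m = suc m} h = projᶜ (h zero) ∷ᶜ lookupsᶜ (h ∘ suc)

  idᶜ : ∀ {n} → Computables {n} id
  idᶜ with lookupsᶜ id
  ... | cs , evs = cs , λ xs → subst (EvalAll cs xs) (tabulate∘lookup xs) (evs xs)

  headᶜ : ∀ {n} → Computable {suc n} head
  headᶜ = computable-ext (λ { (_ ∷ _) → refl }) (projᶜ zero)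

  tailᶜ : ∀ {n} → Computables {suc n} tail
  tailᶜ with lookupsᶜ suc
  ... | cs , evs = cs , λ { (x ∷ xs) → subst (EvalAll cs (x ∷ xs)) (tabulate∘lookup xs) (evs (x ∷ xs)) }

  succᶜ : Computable {1} (suc ∘ head)
  succᶜ = succ , λ { (x ∷ []) → ev-suc }

  sucᶜ : ∀ {n} {f : Vec ℕ n → ℕ} → Computable f → Computable (λ xs → suc (f xs))
  sucᶜ f = _∘ᶜ_ {f = suc ∘ head} succᶜ (f ∷ᶜ []ᶜ)

  constᶜ : ∀ {n} k → Computable {n} (λ _ → k)
  constᶜ zero    = zer , λ _ → ev-zer
  constᶜ (suc k) = sucᶜ (constᶜ k)

-- The function that `prec` computes; `s` takes the index before the previous value, as in
-- `ev-precS`.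
natrec : ℕ → (ℕ → ℕ → ℕ) → ℕ → ℕ
natrec z s zero    = z
natrec z s (suc n) = s n (natrec z s n)

natrecᶜ : ∀ {n} {f : Vec ℕ n → ℕ} {g : Vec ℕ (suc (suc n)) → ℕ} {b : Vec ℕ n → ℕ} →
          Computable f → Computable g → Computable b →
          Computable (λ xs → natrec (f xs) (λ k r → g (k ∷ r ∷ xs)) (b xs))
natrecᶜ {n} {f} {g} (cf , evf) (cg , evg) cb = _∘ᶜ_ {f = F} (prec cf cg , λ { (k ∷ xs) → ev k xs }) (cb ∷ᶜ idᶜ)
  where
  F : Vec ℕ (suc n) → ℕ
  F v = natrec (f (tail v)) (λ k r → g (k ∷ r ∷ tail v)) (head v)
  ev : ∀ k xs → Eval (prec cf cg) (k ∷ xs) (F (k ∷ xs))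
  ev zero    xs = ev-prec0 (evf xs)
  ev (suc k) xs = ev-precS (ev k xs) (evg _)

abstract
  #0ᶜ : ∀ {n} → Computable {suc n} head
  #0ᶜ = headᶜ

  #1ᶜ : ∀ {n} → Computable {suc (suc n)} (head ∘ tail)
  #1ᶜ = headᶜ ∘ᶜ tailᶜ

  #2ᶜ : ∀ {n} → Computable {suc (suc (suc n))} (head ∘ tail ∘ tail)
  #2ᶜ = #1ᶜ ∘ᶜ tailᶜ

  #3ᶜ : ∀ {n} → Computable {suc (suc (suc (suc n)))} (head ∘ tail ∘ tail ∘ tail)
  #3ᶜ = #2ᶜ ∘ᶜ tailᶜ

  predᶜ : ∀ {n} {f : Vec ℕ n → ℕ} → Computable f → Computable (λ xs → pred (f xs))
  predᶜ {f = f} cf = computable-ext (λ xs → eq (f xs)) (natrecᶜ (constᶜ 0) #0ᶜ cf)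
    where
    eq : ∀ k → natrec 0 (λ k _ → k) k ≡ pred k
    eq zero    = refl
    eq (suc k) = refl

  _+ᶜ_ : ∀ {n} {f g : Vec ℕ n → ℕ} → Computable f → Computable g → Computable (λ xs → f xs + g xs)
  _+ᶜ_ {f = f} {g} cf cg = computable-ext (λ xs → eq (g xs) (f xs)) (natrecᶜ cg (sucᶜ #1ᶜ) cf)
    where
    eq : ∀ y k → natrec y (λ _ r → suc r) k ≡ k + y
    eq y zero    = refl
    eq y (suc k) = cong suc (eq y k)

  _∸ᶜ_ : ∀ {n} {f g : Vec ℕ n → ℕ} → Computable f → Computable g → Computable (λ xs → f xs ∸ g xs)
  _∸ᶜ_ {f = f} {g} cf cg = computable-ext (λ xs → eq (f xs) (g xs)) (natrecᶜ cf (predᶜ #1ᶜ) cg)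
    where
    eq : ∀ x k → natrec x (λ _ r → pred r) k ≡ x ∸ k
    eq x zero    = refl
    eq x (suc k) = trans (cong pred (eq x k)) (pred[m∸n]≡m∸[1+n] x k)

if0 : ℕ → ℕ → ℕ → ℕ
if0 zero    a b = a
if0 (suc _) a b = b

if0ᶜ : ∀ {n} {f g h : Vec ℕ n → ℕ} → Computable f → Computable g → Computable h →
       Computable (λ xs → if0 (f xs) (g xs) (h xs))
if0ᶜ {f = f} {g} {h} cf cg ch = computable-ext (λ xs → eq (g xs) (h xs) (f xs)) (natrecᶜ cg (ch ∘ᶜ (tailᶜ ∘ᶜˢ tailᶜ)) cf)
  where
  eq : ∀ a b k → natrec a (λ _ _ → b) k ≡ if0 k a b
  eq a b zero    = refl
  eq a b (suc k) = refl

sum< : ℕ → (ℕ → ℕ) → ℕ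
sum< b f = natrec 0 (λ k r → f k + r) b

sum<ᶜ : ∀ {n} {b : Vec ℕ n → ℕ} {f : Vec ℕ (suc n) → ℕ} → Computable b → Computable f →
        Computable (λ xs → sum< (b xs) (λ k → f (k ∷ xs)))
sum<ᶜ {f = f} cb cf =
  natrecᶜ {g = λ v → f (head v ∷ tail (tail v)) + head (tail v)}
    (constᶜ 0) ((cf ∘ᶜ (#0ᶜ ∷ᶜ (tailᶜ ∘ᶜˢ tailᶜ))) +ᶜ #1ᶜ) cb

-- Kleene stage approximations: for s large, run (s ∷ xs) is 1 + the value of the code at xs;
-- 0 means that no value has been found by stage s.

record Staged {n} (e : PR n) : Set where
  field
    run        : Vec ℕ (suc n) → ℕ
    computable : Computable run
    sound      : ∀ s xs y → run (s ∷ xs) ≡ suc y → Eval e xs y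
    complete   : ∀ xs y → Eval e xs y → Eventually (λ s → run (s ∷ xs) ≡ suc y)

-- A tuple halts when all its components have. `values` carries a default at a component without a
-- value, so it is trusted only where `halted` is positive.
record StagedAll {n m} (es : Vec (PR n) m) : Set where
  field
    halted            : Vec ℕ (suc n) → ℕ
    values            : Vec ℕ (suc n) → Vec ℕ m
    halted-computable : Computable halted
    values-computable : Computables values
    sound             : ∀ s xs {h} → halted (s ∷ xs) ≡ suc h → EvalAll es xs (values (s ∷ xs))
    complete          : ∀ xs ys → EvalAll es xs ys →
                        Eventually (λ s → halted (s ∷ xs) ≡ 1 × values (s ∷ xs) ≡ ys)

abstract
  -- A total code shows its value at every stage. Determinism is an argument because
  -- `eval-deterministic` is itself drawn from the stages.
  total-staged : ∀ {n} {e : PR n} {f : Vec ℕ n → ℕ} → Computable f →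
                 (∀ xs → Eval e xs (f xs)) → (∀ xs y → Eval e xs y → f xs ≡ y) → Staged e
  total-staged {f = f} cf ev det = record
    { run        = suc ∘ f ∘ tail
    ; computable = sucᶜ (cf ∘ᶜ tailᶜ)
    ; sound      = λ { s xs y refl → ev xs }
    ; complete   = λ xs y e → always λ _ → cong suc (det xs y e)
    }

if0-suc : ∀ {c b y} → if0 c 0 b ≡ suc y → ∃ λ c′ → c ≡ suc c′ × b ≡ suc y
if0-suc {suc c} eq = c , refl , eq

abstract
  comp-staged : ∀ {n m} {f : PR m} {gs : Vec (PR n) m} → Staged f → StagedAll gs → Staged (comp f gs)
  comp-staged {n} {m} {f} {gs} F G = record
    { run        = run
    ; computable = if0ᶜ G.halted-computable (constᶜ 0) (F.computable ∘ᶜ (#0ᶜ ∷ᶜ G.values-computable))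
    ; sound      = sound
    ; complete   = complete
    }
    where
    module F = Staged F
    module G = StagedAll G
    run : Vec ℕ (suc n) → ℕ
    run v = if0 (G.halted v) 0 (F.run (head v ∷ G.values v))
    sound : ∀ s xs y → run (s ∷ xs) ≡ suc y → Eval (comp f gs) xs y
    sound s xs y eq with if0-suc {G.halted (s ∷ xs)} eq
    ... | _ , h , r = ev-comp (G.sound s xs h) (F.sound s _ y r)
    complete : ∀ xs y → Eval (comp f gs) xs y → Eventually (λ s → run (s ∷ xs) ≡ suc y)
    complete xs y (ev-comp {ys = ys} es e) =
      eventually-map (λ { s ((h , v) , r) → trans (cong (λ h → if0 h 0 _) h)
                                            (trans (cong (λ v → F.run (s ∷ v)) v) r) })
        (eventually-zip (G.complete xs ys es) (F.complete ys y e))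

  prec-staged : ∀ {n} {f : PR n} {g : PR (suc (suc n))} → Staged f → Staged g → Staged (prec f g)
  prec-staged {n} {f} {g} F G = record
    { run        = λ v → iter (head v) (tail (tail v)) (head (tail v))
    ; computable = natrecᶜ (F.computable ∘ᶜ (#0ᶜ ∷ᶜ (tailᶜ ∘ᶜˢ tailᶜ)))
        (if0ᶜ #1ᶜ (constᶜ 0)
          (G.computable ∘ᶜ ((#0ᶜ ∘ᶜ (tailᶜ ∘ᶜˢ tailᶜ)) ∷ᶜ #0ᶜ ∷ᶜ predᶜ #1ᶜ ∷ᶜ
                            (tailᶜ ∘ᶜˢ tailᶜ ∘ᶜˢ tailᶜ ∘ᶜˢ tailᶜ))))
        #1ᶜ
    ; sound      = λ { s (k ∷ xs) y → sound s xs k y }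
    ; complete   = λ { (k ∷ xs) y → complete xs k y }
    }
    where
    module F = Staged F
    module G = Staged G
    iter : ℕ → Vec ℕ n → ℕ → ℕ
    -- The bound `s` is shared by all rounds; a round without a value passes 0 on, and `pred r`
    -- undoes the shift by one in `r`.
    iter s xs = natrec (F.run (s ∷ xs)) (λ k r → if0 r 0 (G.run (s ∷ k ∷ pred r ∷ xs)))
    sound : ∀ s xs k y → iter s xs k ≡ suc y → Eval (prec f g) (k ∷ xs) y
    sound s xs zero    y eq = ev-prec0 (F.sound s xs y eq)
    sound s xs (suc k) y eq with iter s xs k in eqk
    ... | suc r = ev-precS (sound s xs k r eqk) (G.sound s _ y eq)
    complete : ∀ xs k y → Eval (prec f g) (k ∷ xs) y → Eventually (λ s → iter s xs k ≡ suc y)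
    complete xs zero    y (ev-prec0 e)    = F.complete xs y e
    complete xs (suc k) y (ev-precS {r = r} e e′) =
      eventually-map (λ { s (i , j) → trans (cong (λ i → if0 i 0 (G.run (s ∷ k ∷ pred i ∷ xs))) i) j })
        (eventually-zip (complete xs k r e) (G.complete (k ∷ r ∷ xs) y e′))

  mu-staged : ∀ {n} {f : PR (suc n)} → Staged f → Staged (mu f)
  mu-staged {n} {f} F = record
    -- `pred` sends the searching and the stuck state to 0, and the state 2 + y to 1 + y.
    { run        = λ v → pred (search (head v) (tail v) (head v))
    ; computable = predᶜ (natrecᶜ {g = λ w → step (head (tail (tail w))) (tail (tail (tail w))) (head w) (head (tail w))}
        (constᶜ 0) (if0ᶜ #1ᶜ (if0ᶜ F′ (constᶜ 1) (if0ᶜ (predᶜ F′) (sucᶜ (sucᶜ #0ᶜ)) (constᶜ 0))) #1ᶜ) #0ᶜ)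
    ; sound      = sound
    ; complete   = complete
    }
    where
    module F = Staged F
    -- The state is 0 while searching, 1 when stuck at an undefined value, 2 + y when y is found.
    step : ℕ → Vec ℕ n → ℕ → ℕ → ℕ
    step s xs j st = if0 st (if0 r 1 (if0 (pred r) (suc (suc j)) 0)) st
      where
      r : ℕ
      r = F.run (s ∷ j ∷ xs)
    F′ : Computable (λ w → F.run (head (tail (tail w)) ∷ head w ∷ tail (tail (tail w))))
    F′ = F.computable ∘ᶜ ((#0ᶜ ∘ᶜ (tailᶜ ∘ᶜˢ tailᶜ)) ∷ᶜ #0ᶜ ∷ᶜ (tailᶜ ∘ᶜˢ tailᶜ ∘ᶜˢ tailᶜ))
    search : ℕ → Vec ℕ n → ℕ → ℕ
    search s xs = natrec 0 (step s xs)

    Positive : ℕ → Vec ℕ n → ℕ → Set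
    Positive s xs k = ∃ λ v → F.run (s ∷ k ∷ xs) ≡ suc (suc v)

    Invariant : ℕ → Vec ℕ n → ℕ → ℕ → Set
    Invariant s xs j zero          = ∀ k → k < j → Positive s xs k
    Invariant s xs j (suc zero)    = ⊤
    Invariant s xs j (suc (suc y)) = F.run (s ∷ y ∷ xs) ≡ 1 × (∀ k → k < y → Positive s xs k)

    invariant : ∀ s xs j → Invariant s xs j (search s xs j)
    invariant s xs zero    = λ _ ()
    invariant s xs (suc j) with search s xs j | invariant s xs j
    ... | suc zero    | _   = tt
    ... | suc (suc y) | inv = inv
    ... | zero        | inv with F.run (s ∷ j ∷ xs) in eq
    ...   | zero        = tt
    ...   | suc zero    = eq , inv
    ...   | suc (suc v) = λ k k<1+j → extend k (m<1+n⇒m<n∨m≡n k<1+j)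
      where
      extend : ∀ k → k < j ⊎ k ≡ j → Positive s xs k
      extend k (inj₁ k<j)  = inv k k<j
      extend k (inj₂ refl) = v , eq

    sound : ∀ s xs y → pred (search s xs s) ≡ suc y → Eval (mu f) xs y
    sound s xs y eq with search s xs s | invariant s xs s
    sound s xs y refl | suc (suc y) | found , below =
      ev-mu (F.sound s (y ∷ xs) 0 found)
        (λ k k<y → proj₁ (below k k<y) , F.sound s (k ∷ xs) _ (proj₂ (below k k<y)))

    searching : ∀ s xs j → (∀ k → k < j → Positive s xs k) → search s xs j ≡ 0
    searching s xs zero    below = refl
    searching s xs (suc j) below
      rewrite searching s xs j (λ k k<j → below k (m≤n⇒m≤1+n k<j)) | proj₂ (below j ≤-refl) = refl

    found : ∀ s xs y → F.run (s ∷ y ∷ xs) ≡ 1 → (∀ k → k < y → Positive s xs k) →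
            ∀ d → search s xs (suc (d + y)) ≡ suc (suc y)
    found s xs y at below zero    rewrite searching s xs y below | at = refl
    found s xs y at below (suc d) rewrite found s xs y at below d = refl

    complete : ∀ xs y → Eval (mu f) xs y → Eventually (λ s → pred (search s xs s) ≡ suc y)
    complete xs y (ev-mu e below) =
      eventually-map (λ { s (y<s , at , pos) → cong pred (at-stage s y<s at pos) })
        (eventually-zip (eventually-≥ (suc y)) (eventually-zip (F.complete (y ∷ xs) 0 e)
          (eventually-∀< y λ k k<y → eventually-map (λ _ eq → proj₁ (below k k<y) , eq)
            (F.complete (k ∷ xs) _ (proj₂ (below k k<y))))))
      where
      at-stage : ∀ s → suc y ≤ s → F.run (s ∷ y ∷ xs) ≡ 1 → (∀ k → k < y → Positive s xs k) →
                 search s xs s ≡ suc (suc y)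
      at-stage s y<s at pos =
        subst (λ j → search s xs j ≡ suc (suc y)) (trans (sym (+-suc _ y)) (m∸n+n≡m y<s))
          (found s xs y at pos (s ∸ suc y))

  mutual
    staged : ∀ {n} (e : PR n) → Staged e
    staged zer         = total-staged (constᶜ 0) (λ _ → ev-zer) (λ { _ _ ev-zer → refl })
    staged succ        = total-staged (sucᶜ #0ᶜ) (λ { (x ∷ []) → ev-suc }) (λ { _ _ ev-suc → refl })
    staged (proj i)    = total-staged (projᶜ i) (λ _ → ev-proj) (λ { _ _ ev-proj → refl })
    staged (comp f gs) = comp-staged (staged f) (staged-all gs)
    staged (prec f g)  = prec-staged (staged f) (staged g)
    staged (mu f)      = mu-staged (staged f)

    staged-all : ∀ {n m} (es : Vec (PR n) m) → StagedAll es
    staged-all []       = record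
      { halted            = λ _ → 1
      ; values            = λ _ → []
      ; halted-computable = constᶜ 1
      ; values-computable = []ᶜ
      ; sound             = λ _ _ _ → []
      ; complete          = λ { _ _ [] → always λ _ → refl , refl }
      }
    staged-all (e ∷ es) = staged-∷ (staged e) (staged-all es)

    staged-∷ : ∀ {n m} {e : PR n} {es : Vec (PR n) m} → Staged e → StagedAll es → StagedAll (e ∷ es)
    staged-∷ {n} {m} {e} {es} F G = record
      { halted            = halted
      ; values            = λ v → pred (F.run v) ∷ G.values v
      ; halted-computable = if0ᶜ F.computable (constᶜ 0) G.halted-computable
      ; values-computable = predᶜ F.computable ∷ᶜ G.values-computable
      ; sound             = sound
      ; complete          = complete
      }
      where
      module F = Staged F
      module G = StagedAll G
      halted : Vec ℕ (suc n) → ℕ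
      halted v = if0 (F.run v) 0 (G.halted v)
      sound : ∀ s xs {h} → halted (s ∷ xs) ≡ suc h →
              EvalAll (e ∷ es) xs (pred (F.run (s ∷ xs)) ∷ G.values (s ∷ xs))
      sound s xs eq with F.run (s ∷ xs) in eq′
      ... | suc y = F.sound s xs y eq′ ∷ G.sound s xs eq
      complete : ∀ xs ys → EvalAll (e ∷ es) xs ys → Eventually (λ s → halted (s ∷ xs) ≡ 1 ×
                   pred (F.run (s ∷ xs)) ∷ G.values (s ∷ xs) ≡ ys)
      complete xs (y ∷ ys) (e ∷ es) =
        eventually-map (λ { s (r , h , v) → trans (cong (λ r → if0 r 0 _) r) h , cong₂ _∷_ (cong pred r) v })
          (eventually-zip (F.complete xs y e) (G.complete xs ys es))

-- A late stage shows both values, and `run` is a function.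
eval-deterministic : ∀ {n} {e : PR n} {xs y z} → Eval e xs y → Eval e xs z → y ≡ z
eval-deterministic {e = e} {xs} {y} {z} p q
  with eventually-witness (eventually-zip (complete xs y p) (complete xs z q))
  where open Staged (staged e)
... | _ , eq , eq′ = suc-injective (trans (sym eq) eq′)

-- Decidable relations

-- Truth is the value 0: conjunction becomes addition, a bounded universal quantifier a sum, `≤`
-- truncated subtraction, and `mu` can search for it directly.
record Decider {n} (P : Vec ℕ n → Set) : Set where
  field
    test       : Vec ℕ n → ℕ
    computable : Computable test
    sound      : ∀ xs → test xs ≡ 0 → P xs
    complete   : ∀ xs → P xs → test xs ≡ 0

abstract
  mapᵈ : ∀ {n} {P Q : Vec ℕ n → Set} → (∀ xs → P xs → Q xs) → (∀ xs → Q xs → P xs) → Decider P → Decider Q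
  mapᵈ f g P = record
    { test = P.test ; computable = P.computable
    ; sound = λ xs eq → f xs (P.sound xs eq) ; complete = λ xs q → P.complete xs (g xs q) }
    where module P = Decider P

  _[_]ᵈ : ∀ {n m} {P : Vec ℕ m → Set} {f : Vec ℕ n → Vec ℕ m} → Decider P → Computables f → Decider (P ∘ f)
  _[_]ᵈ {f = f} P cf = record
    { test = P.test ∘ f ; computable = P.computable ∘ᶜ cf
    ; sound = λ xs → P.sound (f xs) ; complete = λ xs → P.complete (f xs) }
    where module P = Decider P

infixr 2 _×ᵈ_ _×ˢ_

abstract
  _×ᵈ_ : ∀ {n} {P Q : Vec ℕ n → Set} → Decider P → Decider Q → Decider (λ xs → P xs × Q xs)
  P ×ᵈ Q = record
    { test       = λ xs → P.test xs + Q.test xs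
    ; computable = P.computable +ᶜ Q.computable
    ; sound      = λ xs eq → P.sound xs (m+n≡0⇒m≡0 (P.test xs) eq) , Q.sound xs (m+n≡0⇒n≡0 (P.test xs) eq)
    ; complete   = λ xs pq → cong₂ _+_ (P.complete xs (proj₁ pq)) (Q.complete xs (proj₂ pq))
    }
    where
    module P = Decider P
    module Q = Decider Q

  ¬ᵈ_ : ∀ {n} {P : Vec ℕ n → Set} → Decider P → Decider (λ xs → ¬ P xs)
  ¬ᵈ_ {P = P} D = record
    { test       = λ xs → 1 ∸ D.test xs
    ; computable = constᶜ 1 ∸ᶜ D.computable
    ; sound      = λ xs eq p → 1≢0 (subst (λ t → 1 ∸ t ≡ 0) (D.complete xs p) eq)
    ; complete   = complete
    }
    where
    module D = Decider D
    1≢0 : 1 ≢ 0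
    1≢0 ()
    complete : ∀ xs → ¬ P xs → 1 ∸ D.test xs ≡ 0
    complete xs ¬p with D.test xs in eq
    ... | zero  = ⊥-elim (¬p (D.sound xs eq))
    ... | suc t = 0∸n≡0 t

  _≤ᵈ_ : ∀ {n} {f g : Vec ℕ n → ℕ} → Computable f → Computable g → Decider (λ xs → f xs ≤ g xs)
  _≤ᵈ_ {f = f} {g} cf cg = record
    { test = λ xs → f xs ∸ g xs ; computable = cf ∸ᶜ cg
    ; sound = λ xs → m∸n≡0⇒m≤n ; complete = λ xs → m≤n⇒m∸n≡0 }

  _≡ᵈ_ : ∀ {n} {f g : Vec ℕ n → ℕ} → Computable f → Computable g → Decider (λ xs → f xs ≡ g xs)
  cf ≡ᵈ cg = mapᵈ (λ _ (le , ge) → ≤-antisym le ge) (λ _ eq → ≤-reflexive eq , ≤-reflexive (sym eq))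
               ((cf ≤ᵈ cg) ×ᵈ (cg ≤ᵈ cf))

sum<≡0 : ∀ b f → (∀ k → k < b → f k ≡ 0) → sum< b f ≡ 0
sum<≡0 zero    f zeros = refl
sum<≡0 (suc b) f zeros = cong₂ _+_ (zeros b ≤-refl) (sum<≡0 b f λ k k<b → zeros k (m≤n⇒m≤1+n k<b))

sum<≡0⁻¹ : ∀ b f → sum< b f ≡ 0 → ∀ k → k < b → f k ≡ 0
sum<≡0⁻¹ (suc b) f eq k k<1+b with m<1+n⇒m<n∨m≡n k<1+b
... | inj₁ k<b  = sum<≡0⁻¹ b f (m+n≡0⇒n≡0 (f b) eq) k k<b
... | inj₂ refl = m+n≡0⇒m≡0 (f b) eq

∀<ᵈ : ∀ {n} {P : Vec ℕ (suc n) → Set} {b : Vec ℕ n → ℕ} → Computable b → Decider P →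
      Decider (λ xs → ∀ k → k < b xs → P (k ∷ xs))
∀<ᵈ {b = b} cb P = record
  { test       = λ xs → sum< (b xs) (λ k → P.test (k ∷ xs))
  ; computable = sum<ᶜ cb P.computable
  ; sound      = λ xs eq k k<b → P.sound _ (sum<≡0⁻¹ (b xs) _ eq k k<b)
  ; complete   = λ xs all → sum<≡0 (b xs) _ λ k k<b → P.complete _ (all k k<b)
  }
  where module P = Decider P

-- Semidecidable relations

-- All stages past a threshold must accept, so that the parts of a conjunction have a common
-- accepting stage.
record Semidecider {n} (S : Vec ℕ n → Set) : Set₁ where
  field
    stage    : Vec ℕ (suc n) → Set
    decider  : Decider stage
    sound    : ∀ s xs → stage (s ∷ xs) → S xs
    complete : ∀ xs → S xs → Eventually (λ s → stage (s ∷ xs))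

abstract
  decidable : ∀ {n} {P : Vec ℕ n → Set} → Decider P → Semidecider P
  decidable {P = P} D = record
    { stage = P ∘ tail ; decider = D [ tailᶜ ]ᵈ
    ; sound = λ _ _ p → p ; complete = λ _ p → always λ _ → p }

  _[_]ˢ : ∀ {n m} {S : Vec ℕ m → Set} {f : Vec ℕ n → Vec ℕ m} → Semidecider S → Computables f → Semidecider (S ∘ f)
  _[_]ˢ {f = f} S cf = record
    { stage = λ v → S.stage (head v ∷ f (tail v)) ; decider = S.decider [ #0ᶜ ∷ᶜ cf ∘ᶜˢ tailᶜ ]ᵈ
    ; sound = λ s xs → S.sound s (f xs) ; complete = λ xs → S.complete (f xs) }
    where module S = Semidecider S

  _×ˢ_ : ∀ {n} {S T : Vec ℕ n → Set} → Semidecider S → Semidecider T → Semidecider (λ xs → S xs × T xs)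
  S ×ˢ T = record
    { stage    = λ v → S.stage v × T.stage v
    ; decider  = S.decider ×ᵈ T.decider
    ; sound    = λ s xs (p , q) → S.sound s xs p , T.sound s xs q
    ; complete = λ xs (p , q) → eventually-zip (S.complete xs p) (T.complete xs q)
    }
    where
    module S = Semidecider S
    module T = Semidecider T

  graphˢ : ∀ {n} (e : PR n) → Semidecider (λ v → Eval e (tail v) (head v))
  graphˢ e = record
    { stage    = λ v → run (head v ∷ tail (tail v)) ≡ suc (head (tail v))
    ; decider  = (computable ∘ᶜ (#0ᶜ ∷ᶜ tailᶜ ∘ᶜˢ tailᶜ)) ≡ᵈ sucᶜ #1ᶜ
    ; sound    = λ { s (y ∷ xs) → sound s xs y }
    ; complete = λ { (y ∷ xs) → complete xs y }
    }
    where open Staged (staged e)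

eval-all-deterministic : ∀ {n m} {es : Vec (PR n) m} {xs ys zs} → EvalAll es xs ys → EvalAll es xs zs → ys ≡ zs
eval-all-deterministic []       []       = refl
eval-all-deterministic (p ∷ ps) (q ∷ qs) = cong₂ _∷_ (eval-deterministic p q) (eval-all-deterministic ps qs)

-- Classical search, existential quantifiers and characteristic functions

module Classical (em : ExcludedMiddle 0ℓ) where

  dne : {A : Set} → ¬ ¬ A → A
  dne {A} ¬¬a with em {A}
  ... | yes a = a
  ... | no ¬a = ⊥-elim (¬¬a ¬a)

  least : {P : ℕ → Set} → ∃ P → ∃ λ n → P n × (∀ m → m < n → ¬ P m)
  least {P} (n , p) = go (suc n) (n , ≤-refl , p)
    where
    go : ∀ b → (∃ λ n → n < b × P n) → ∃ λ n → P n × (∀ m → m < n → ¬ P m)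
    go (suc b) (n , n<1+b , p) with em {∃ λ m → m < b × P m}
    ... | yes below = go b below
    ... | no ¬below = n , p , λ m m<n q → ¬below (m , <-≤-trans m<n (s≤s⁻¹ n<1+b) , q)

  ∃<ᵈ : ∀ {n} {P : Vec ℕ (suc n) → Set} {b : Vec ℕ n → ℕ} → Computable b → Decider P →
        Decider (λ xs → ∃ λ k → k < b xs × P (k ∷ xs))
  ∃<ᵈ cb P = mapᵈ (λ _ ¬all → dne λ ¬any → ¬all λ k k<b p → ¬any (k , k<b , p))
                  (λ _ (k , k<b , p) all → all k k<b p)
                  (¬ᵈ ∀<ᵈ cb (¬ᵈ P))

  abstract
    -- Excluded middle defines `χ` as a function, and `e` computes it; `1 ∸ χ` turns its truth value
    -- 1 into 0.
    characteristic-decider : ∀ {n} {P : Vec ℕ n → Set} (e : PR n) →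
      (∀ xs → (P xs → Eval e xs 1) × (¬ P xs → Eval e xs 0)) → Decider P
    characteristic-decider {n} {P} e ev = record
      { test       = λ xs → 1 ∸ χ xs
      ; computable = constᶜ 1 ∸ᶜ (e , χ-eval)
      ; sound      = sound
      ; complete   = complete
      }
      where
      χ : Vec ℕ n → ℕ
      χ xs with em {P xs}
      ... | yes _ = 1
      ... | no  _ = 0
      χ-eval : ∀ xs → Eval e xs (χ xs)
      χ-eval xs with em {P xs}
      ... | yes p = proj₁ (ev xs) p
      ... | no ¬p = proj₂ (ev xs) ¬p
      sound : ∀ xs → 1 ∸ χ xs ≡ 0 → P xs
      sound xs eq with em {P xs}
      ... | yes p = p
      complete : ∀ xs → P xs → 1 ∸ χ xs ≡ 0
      complete xs p with em {P xs}
      ... | yes _ = refl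
      ... | no ¬p = ⊥-elim (¬p p)

    -- Bounding the witness by the stage keeps each stage decidable, and a given witness is below
    -- all large stages.
    ∃ˢ : ∀ {n} {S : Vec ℕ (suc n) → Set} → Semidecider S → Semidecider (λ xs → ∃ λ y → S (y ∷ xs))
    ∃ˢ S = record
      { stage    = λ v → ∃ λ y → y < head v × S.stage (head v ∷ y ∷ tail v)
      ; decider  = ∃<ᵈ #0ᶜ (S.decider [ #1ᶜ ∷ᶜ #0ᶜ ∷ᶜ tailᶜ ∘ᶜˢ tailᶜ ]ᵈ)
      ; sound    = λ s xs (y , _ , p) → y , S.sound s (y ∷ xs) p
      ; complete = λ xs (y , p) → eventually-map (λ s (q , y<s) → y , y<s , q)
                                    (eventually-zip (S.complete (y ∷ xs) p) (eventually-≥ (suc y)))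
      }
      where module S = Semidecider S

  -- Uniformization

  -- A partial computable choice function, defined exactly where a witness exists; the chosen
  -- witness may differ from the given `y`.
  Uniformizer : ∀ {n} → (Vec ℕ (suc n) → Set) → Set
  Uniformizer {n} S = Σ (PR n) λ c →
    (∀ xs y → Eval c xs y → S (y ∷ xs)) × (∀ xs y → S (y ∷ xs) → ∃ λ z → Eval c xs z)

  abstract
    -- `ev-mu` demands nonzero tests at all smaller arguments, hence the passage to the least
    -- witness.
    μ-search : ∀ {n} {P : Vec ℕ (suc n) → Set} → Decider P → Uniformizer P
    μ-search {n} {P} D = mu c , sound , complete
      where
      module D = Decider D
      c : PR (suc n)
      c = proj₁ D.computable
      ev : ∀ xs → Eval c xs (D.test xs)
      ev = proj₂ D.computable
      sound : ∀ xs y → Eval (mu c) xs y → P (y ∷ xs)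
      sound xs y (ev-mu e _) = D.sound (y ∷ xs) (eval-deterministic (ev (y ∷ xs)) e)
      complete : ∀ xs y → P (y ∷ xs) → ∃ λ z → Eval (mu c) xs z
      complete xs y p with least {P = λ z → D.test (z ∷ xs) ≡ 0} (y , D.complete (y ∷ xs) p)
      ... | z , eq , below = z , ev-mu (subst (Eval c (z ∷ xs)) eq (ev (z ∷ xs))) nonzero
        where
        nonzero : ∀ k → k < z → Σ ℕ λ v → Eval c (k ∷ xs) (suc v)
        nonzero k k<z with D.test (k ∷ xs) | ev (k ∷ xs) | below k k<z
        ... | zero  | _ | ≢0 = ⊥-elim (≢0 refl)
        ... | suc v | e | _  = v , e

    -- Two unbounded searches are composed: the first finds a stage accepting some witness below it,
    -- the second a witness accepted at that stage.
    uniformize : ∀ {n} {S : Vec ℕ (suc n) → Set} → Semidecider S → Uniformizer S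
    uniformize {n} {S} D = comp value (stage ∷ proj₁ ids) , sound , complete
      where
      module D = Semidecider D
      stage-search : Uniformizer (λ v → ∃ λ y → y < head v × D.stage (head v ∷ y ∷ tail v))
      stage-search = μ-search (∃<ᵈ #0ᶜ (D.decider [ #1ᶜ ∷ᶜ #0ᶜ ∷ᶜ tailᶜ ∘ᶜˢ tailᶜ ]ᵈ))
      value-search : Uniformizer (λ v → D.stage (head (tail v) ∷ head v ∷ tail (tail v)))
      value-search = μ-search (D.decider [ #1ᶜ ∷ᶜ #0ᶜ ∷ᶜ tailᶜ ∘ᶜˢ tailᶜ ]ᵈ)
      ids : Computables {n} id
      ids = idᶜ
      stage : PR n
      stage = proj₁ stage-search
      value : PR (suc n)
      value = proj₁ value-search
      sound : ∀ xs y → Eval (comp value (stage ∷ proj₁ ids)) xs y → S (y ∷ xs)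
      sound xs y (ev-comp {ys = t ∷ ys} (_ ∷ es) e) = D.sound t (y ∷ xs)
        (subst (λ ys → D.stage (t ∷ y ∷ ys)) (eval-all-deterministic es (proj₂ ids xs))
          (proj₁ (proj₂ value-search) (t ∷ ys) y e))
      complete : ∀ xs y → S (y ∷ xs) → ∃ λ z → Eval (comp value (stage ∷ proj₁ ids)) xs z
      complete xs y p = run (eventually-witness (eventually-zip (D.complete (y ∷ xs) p) (eventually-≥ (suc y))))
        where
        run : (∃ λ t → D.stage (t ∷ y ∷ xs) × y < t) → ∃ λ z → Eval (comp value (stage ∷ proj₁ ids)) xs z
        run (t , t-stage , y<t) =
          let t′ , e             = proj₂ (proj₂ stage-search) xs t (y , y<t , t-stage)
              y′ , _ , t′-stage  = proj₁ (proj₂ stage-search) xs t′ e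
              z , e′             = proj₂ (proj₂ value-search) (t′ ∷ xs) y′ t′-stage
          in z , ev-comp (e ∷ proj₂ ids xs) e′

  -- With a dummy value coordinate every value is a witness, so the domain of the uniformizing code
  -- is `S`.
  domain-code : ∀ {S : Vec ℕ 1 → Set} → Semidecider S → Σ (PR 1) λ e →
                (∀ x → S (x ∷ []) → W e x) × (∀ x → W e x → S (x ∷ []))
  domain-code {S} D = proj₁ u , (λ x p → proj₂ (proj₂ u) (x ∷ []) 0 p) , λ x (y , e) → proj₁ (proj₂ u) (x ∷ []) y e
    where
    u : Uniformizer (S ∘ tail)
    u = uniformize (D [ tailᶜ ]ˢ)

-- Coding by natural numbers

-- pair a b = 2ᵃ (2b + 1)
pair : ℕ → ℕ → ℕ
pair zero    b = suc (2 * b)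
pair (suc a) b = 2 * pair a b

pair-injective : ∀ a b c d → pair a b ≡ pair c d → a ≡ c × b ≡ d
pair-injective zero    b zero    d eq = refl , *-cancelˡ-≡ b d 2 (suc-injective eq)
pair-injective zero    b (suc c) d eq = ⊥-elim (even≢odd (pair c d) b (sym eq))
pair-injective (suc a) b zero    d eq = ⊥-elim (even≢odd (pair a b) d eq)
pair-injective (suc a) b (suc c) d eq with pair-injective a b c d (*-cancelˡ-≡ (pair a b) (pair c d) 2 eq)
... | a≡c , b≡d = cong suc a≡c , b≡d

tag : ∀ {n} → PR n → ℕ
tag zer        = 0
tag succ       = 1
tag (proj _)   = 2
tag (comp _ _) = 3
tag (prec _ _) = 4
tag (mu _)     = 5

mutual
  encode : ∀ {n} → PR n → ℕ
  encode e = pair (tag e) (encode-args e)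

  encode-args : ∀ {n} → PR n → ℕ
  encode-args zer              = 0
  encode-args succ             = 0
  encode-args (proj i)         = toℕ i
  -- The middle arity is stored because the type of a composition does not determine it.
  encode-args (comp {m = m} f gs) = pair m (pair (encode f) (encode-all gs))
  encode-args (prec f g)       = pair (encode f) (encode g)
  encode-args (mu f)           = encode f

  encode-all : ∀ {n m} → Vec (PR n) m → ℕ
  encode-all []       = 0
  encode-all (e ∷ es) = pair (encode e) (encode-all es)

mutual
  encode-injective : ∀ {n} (d e : PR n) → encode d ≡ encode e → d ≡ e
  encode-injective d e eq with pair-injective (tag d) (encode-args d) (tag e) (encode-args e) eq
  ... | same-tag , same-args = encode-args-injective d e same-tag same-args

  encode-args-injective : ∀ {n} (d e : PR n) → tag d ≡ tag e → encode-args d ≡ encode-args e → d ≡ e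
  encode-args-injective zer zer refl eq = refl
  encode-args-injective succ succ refl eq = refl
  encode-args-injective (proj i) (proj j) refl eq = cong proj (toℕ-injective eq)
  encode-args-injective (comp {m = m} f gs) (comp {m = m′} f′ gs′) refl eq
    with refl , eq′ ← pair-injective m (pair (encode f) (encode-all gs)) m′ (pair (encode f′) (encode-all gs′)) eq
    with eqf , eqgs ← pair-injective (encode f) (encode-all gs) (encode f′) (encode-all gs′) eq′ =
    cong₂ comp (encode-injective f f′ eqf) (encode-all-injective gs gs′ eqgs)
  encode-args-injective (prec f g) (prec f′ g′) refl eq
    with eqf , eqg ← pair-injective (encode f) (encode g) (encode f′) (encode g′) eq =
    cong₂ prec (encode-injective f f′ eqf) (encode-injective g g′ eqg)
  encode-args-injective (mu f) (mu f′) refl eq = cong mu (encode-injective f f′ eq)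

  encode-all-injective : ∀ {n m} (ds es : Vec (PR n) m) → encode-all ds ≡ encode-all es → ds ≡ es
  encode-all-injective []       []       eq = refl
  encode-all-injective (d ∷ ds) (e ∷ es) eq
    with eq₁ , eq₂ ← pair-injective (encode d) (encode-all ds) (encode e) (encode-all es) eq =
    cong₂ _∷_ (encode-injective d e eq₁) (encode-all-injective ds es eq₂)

-- Cantor's theorem

-- A strict weak order; its classes are those of the incomparability relation.
record DenseRay (M : Set) : Set₁ where
  field
    _⊏_     : M → M → Set
    irrefl  : ∀ {x} → ¬ x ⊏ x
    transit : ∀ {x y z} → x ⊏ y → y ⊏ z → x ⊏ z
    cotrans : ∀ {x z} y → x ⊏ z → x ⊏ y ⊎ y ⊏ z
    origin  : M
    bottom  : ∀ {x} → ¬ x ⊏ origin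
    dense   : ∀ {x y} → x ⊏ y → ∃ λ z → x ⊏ z × z ⊏ y
    above   : ∀ x → ∃ λ y → x ⊏ y

-- Countability concerns classes: elements with equal codes lie in one class, while one class may
-- carry many codes.
record CountableRay (M : Set) : Set₁ where
  field
    ray       : DenseRay M
  open DenseRay ray public
  field
    code      : M → ℕ
    same-code : ∀ {x y} → code x ≡ code y → ¬ x ⊏ y

iff-true : {A B : Set} → A → B → A ⇔ B
iff-true a b = mk⇔ (λ _ → b) (λ _ → a)

iff-false : {A B : Set} → ¬ A → ¬ B → A ⇔ B
iff-false ¬a ¬b = mk⇔ (⊥-elim ∘ ¬a) (⊥-elim ∘ ¬b)

-- Back-and-forth between dense rays on the natural numbers

module BackAndForth (em : ExcludedMiddle 0ℓ) where
  open Classical em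

  -- `P` picks the candidates, such as the points on one side of a new one; the reversed order
  -- yields minimal elements.
  maximal : {X : Set} (_⊏_ : X → X → Set) → (∀ {x} → ¬ x ⊏ x) → (∀ {x y z} → x ⊏ y → y ⊏ z → x ⊏ z) →
            (P : X → Set) (xs : List X) → (∃ λ x → x ∈ xs × P x) →
            ∃ λ m → m ∈ xs × P m × (∀ x → x ∈ xs → P x → ¬ m ⊏ x)
  maximal _⊏_ irrefl transit P (x ∷ xs) (y , y∈ , py) with em {∃ λ z → z ∈ xs × P z}
  maximal _⊏_ irrefl transit P (x ∷ xs) (y , there y∈ , py) | no none = ⊥-elim (none (y , y∈ , py))
  maximal _⊏_ irrefl transit P (x ∷ xs) (y , here refl , py) | no none =
    x , here refl , py , λ { _ (here refl) _ → irrefl ; z (there z∈) pz _ → none (z , z∈ , pz) }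
  maximal _⊏_ irrefl transit P (x ∷ xs) _ | yes some with maximal _⊏_ irrefl transit P xs some
  ... | m , m∈ , pm , max with em {P x × m ⊏ x}
  ...   | yes (px , m⊏x) = x , here refl , px ,
            λ { _ (here refl) _ → irrefl ; z (there z∈) pz x⊏z → max z z∈ pz (transit m⊏x x⊏z) }
  ...   | no ¬x = m , there m∈ , pm ,
            λ { _ (here refl) px m⊏x → ¬x (px , m⊏x) ; z (there z∈) pz → max z z∈ pz }

  -- A finite partial map is a list of indices with two coordinates, so that swapping `a` and `b`
  -- turns the forth step into the back step.
  module Extension (A B : DenseRay ℕ) {I : Set} (a b : I → ℕ) where
    private
      module A = DenseRay A
      module B = DenseRay B

    Iso : List I → Set
    Iso is = ∀ i j → i ∈ is → j ∈ is → a i A.⊏ a j ⇔ b i B.⊏ b j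

    SamePosition : I → ℕ → ℕ → Set
    SamePosition i x y = (a i A.⊏ x ⇔ b i B.⊏ y) × (x A.⊏ a i ⇔ y B.⊏ b i)

    lower : ∀ {i x y} → a i A.⊏ x → b i B.⊏ y → SamePosition i x y
    lower p q = iff-true p q , iff-false (A.irrefl ∘ A.transit p) (B.irrefl ∘ B.transit q)

    upper : ∀ {i x y} → x A.⊏ a i → y B.⊏ b i → SamePosition i x y
    upper p q = iff-false (A.irrefl ∘ A.transit p) (B.irrefl ∘ B.transit q) , iff-true p q

    -- The new point is in the class of a listed one, above all of them, or between two neighbours
    -- `l` and `r`; the answer is the partner of the listed one, a point from `B.above`, or one from
    -- `B.dense`.
    extend : ∀ is i₀ → i₀ ∈ is → a i₀ ≡ A.origin → Iso is → ∀ x → ∃ λ y → ∀ i → i ∈ is → SamePosition i x y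
    extend is i₀ i₀∈ a₀ iso x with em {∃ λ i → i ∈ is × ¬ a i A.⊏ x × ¬ x A.⊏ a i}
    ... | yes (i , i∈ , i≮x , x≮i) = b i , λ j j∈ →
            mk⇔ (λ j<x → to (iso j i j∈ i∈) (<-i j<x)) (λ j<i → <-x (from (iso j i j∈ i∈) j<i)) ,
            mk⇔ (λ x<j → to (iso i j i∈ j∈) (i-< x<j)) (λ i<j → x-< (from (iso i j i∈ j∈) i<j))
      where
      <-i : ∀ {y} → y A.⊏ x → y A.⊏ a i
      <-i y<x with A.cotrans (a i) y<x
      ... | inj₁ y<i = y<i
      ... | inj₂ i<x = ⊥-elim (i≮x i<x)
      <-x : ∀ {y} → y A.⊏ a i → y A.⊏ x
      <-x y<i with A.cotrans x y<i
      ... | inj₁ y<x = y<x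
      ... | inj₂ x<i = ⊥-elim (x≮i x<i)
      i-< : ∀ {y} → x A.⊏ y → a i A.⊏ y
      i-< x<y with A.cotrans (a i) x<y
      ... | inj₁ x<i = ⊥-elim (x≮i x<i)
      ... | inj₂ i<y = i<y
      x-< : ∀ {y} → a i A.⊏ y → x A.⊏ y
      x-< i<y with A.cotrans x i<y
      ... | inj₁ i<x = ⊥-elim (i≮x i<x)
      ... | inj₂ x<y = x<y
    ... | no apart with maximal (λ i j → a i A.⊏ a j) A.irrefl A.transit (λ i → a i A.⊏ x) is (i₀ , i₀∈ , i₀<x)
      where
      i₀<x : a i₀ A.⊏ x
      -- The listed origin guarantees a neighbour below: nothing is below the origin, and `x` is not
      -- in its class.
      i₀<x = dne λ i₀≮x → apart (i₀ , i₀∈ , i₀≮x , λ x<i₀ → A.bottom (subst (x A.⊏_) a₀ x<i₀))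
    ...   | l , l∈ , l<x , l-max = result
      where
      compare : ∀ i → i ∈ is → a i A.⊏ x ⊎ x A.⊏ a i
      compare i i∈ with em {a i A.⊏ x} | em {x A.⊏ a i}
      ... | yes i<x | _       = inj₁ i<x
      ... | no _    | yes x<i = inj₂ x<i
      ... | no i≮x  | no x≮i  = ⊥-elim (apart (i , i∈ , i≮x , x≮i))
      lower-of : ∀ {y} → b l B.⊏ y → ∀ i → i ∈ is → a i A.⊏ x → b i B.⊏ y
      lower-of l<y i i∈ i<x with B.cotrans (b i) l<y
      ... | inj₁ l<i = ⊥-elim (l-max i i∈ i<x (from (iso l i l∈ i∈) l<i))
      ... | inj₂ i<y = i<y
      result : ∃ λ y → ∀ i → i ∈ is → SamePosition i x y
      result with em {∃ λ i → i ∈ is × x A.⊏ a i}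
      ... | no none with B.above (b l)
      ...   | y , l<y = y , λ i i∈ → position i i∈ (compare i i∈)
        where
        position : ∀ i → i ∈ is → a i A.⊏ x ⊎ x A.⊏ a i → SamePosition i x y
        position i i∈ (inj₁ i<x) = lower i<x (lower-of l<y i i∈ i<x)
        position i i∈ (inj₂ x<i) = ⊥-elim (none (i , i∈ , x<i))
      result | yes some
        with maximal (λ i j → a j A.⊏ a i) A.irrefl (flip A.transit) (λ i → x A.⊏ a i) is some
      ... | r , r∈ , x<r , r-min with B.dense (to (iso l r l∈ r∈) (A.transit l<x x<r))
      ...   | y , l<y , y<r = y , λ i i∈ → position i i∈ (compare i i∈)
        where
        upper-of : ∀ i → i ∈ is → x A.⊏ a i → y B.⊏ b i
        upper-of i i∈ x<i with B.cotrans (b i) y<r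
        ... | inj₁ y<i = y<i
        ... | inj₂ i<r = ⊥-elim (r-min i i∈ x<i (from (iso i r i∈ r∈) i<r))
        position : ∀ i → i ∈ is → a i A.⊏ x ⊎ x A.⊏ a i → SamePosition i x y
        position i i∈ (inj₁ i<x) = lower i<x (lower-of l<y i i∈ i<x)
        position i i∈ (inj₂ x<i) = upper x<i (upper-of i i∈ x<i)

    iso-∷ : ∀ {is} i → Iso is → (∀ j → j ∈ is → SamePosition j (a i) (b i)) → Iso (i ∷ is)
    iso-∷ i iso pos _ _ (here refl) (here refl) = iff-false A.irrefl B.irrefl
    iso-∷ i iso pos _ k (here refl) (there k∈)  = proj₂ (pos k k∈)
    iso-∷ i iso pos j _ (there j∈)  (here refl) = proj₁ (pos j j∈)
    iso-∷ i iso pos j k (there j∈)  (there k∈)  = iso j k j∈ k∈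

  module _ (A B : DenseRay ℕ) where
    private
      module A = DenseRay A
      module B = DenseRay B
      module Forth = Extension A B {ℕ × ℕ} proj₁ proj₂
      module Back  = Extension B A {ℕ × ℕ} proj₂ proj₁

      base : ℕ × ℕ
      base = A.origin , B.origin

      State : Set
      State = Σ (List (ℕ × ℕ)) λ ps → base ∈ ps × Forth.Iso ps

      forth : ((ps , _) : State) (x : ℕ) → ∃ λ y → Forth.Iso ((x , y) ∷ ps)
      forth (ps , base∈ , iso) x with Forth.extend ps base base∈ refl iso x
      ... | y , pos = y , Forth.iso-∷ (x , y) iso pos

      back : ((ps , _) : State) (y : ℕ) → ∃ λ x → Forth.Iso ((x , y) ∷ ps)
      back (ps , base∈ , iso) y with Back.extend ps base base∈ refl (λ i j i∈ j∈ → ⇔-sym (iso i j i∈ j∈)) y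
      ... | x , pos = x , Forth.iso-∷ (x , y) iso λ j j∈ → ⇔-sym (proj₁ (pos j j∈)) , ⇔-sym (proj₂ (pos j j∈))

      add-forth : State → ℕ → State
      add-forth st@(ps , base∈ , _) x = _ , there base∈ , proj₂ (forth st x)

      add-back : State → ℕ → State
      add-back st@(ps , base∈ , _) y = _ , there base∈ , proj₂ (back st y)

      state : ℕ → State
      state zero    = base ∷ [] , here refl , Forth.iso-∷ base (λ _ _ ()) (λ _ ())
      state (suc n) = add-back (add-forth (state n) n) n

      pairs : ℕ → List (ℕ × ℕ)
      pairs n = proj₁ (state n)

      image : ℕ → ℕ
      image x = proj₁ (forth (state x) x)

      preimage : ℕ → ℕ
      preimage y = proj₁ (back (add-forth (state y) y) y)

      Paired : ℕ → ℕ → Set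
      Paired x y = ∃ λ n → (x , y) ∈ pairs n

      image-paired : ∀ x → Paired x (image x)
      image-paired x = suc x , there (here refl)

      preimage-paired : ∀ y → Paired (preimage y) y
      preimage-paired y = suc y , here refl

      pairs-mono : ∀ {p n} d → p ∈ pairs n → p ∈ pairs (d + n)
      pairs-mono zero    p∈ = p∈
      -- Each stage puts two pairs in front.
      pairs-mono {n = n} (suc d) p∈ = there (there (pairs-mono {n = n} d p∈))

      -- Both pairs lie in one later list, and that list is a partial isomorphism.
      paired-iso : ∀ {x y x′ y′} → Paired x y → Paired x′ y′ → x A.⊏ x′ ⇔ y B.⊏ y′
      paired-iso {x} {y} {x′} {y′} (m , p∈) (n , q∈) =
        proj₂ (proj₂ (state (n + m))) (x , y) (x′ , y′) (pairs-mono {n = m} n p∈)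
          (subst (λ k → (x′ , y′) ∈ pairs k) (+-comm m n) (pairs-mono {n = n} m q∈))

    -- `image` uses the partner fixed at the stage of its argument. At a chosen preimage of `y` this
    -- partner may differ from `y` but lies in its class, hence surjectivity up to incomparability.
    Isomorphism : Set
    Isomorphism = Σ (ℕ → ℕ) λ f → (∀ x y → x A.⊏ y ⇔ f x B.⊏ f y) ×
                                  (∀ y → ∃ λ x → ¬ f x B.⊏ y × ¬ y B.⊏ f x)

    abstract
      dense-rays-isomorphic : Isomorphism
      dense-rays-isomorphic = image , (λ x y → paired-iso (image-paired x) (image-paired y)) , λ y → preimage y ,
        (λ lt → A.irrefl (from (paired-iso (image-paired (preimage y)) (preimage-paired y)) lt)) ,
        (λ lt → A.irrefl (from (paired-iso (preimage-paired y) (image-paired (preimage y))) lt))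

-- The order `1 + η` as a countable dense ray

encodeℤ : ℤ → ℕ
encodeℤ (+ℤ n)    = pair 0 n
encodeℤ -[1+ n ] = pair 1 n

encodeℤ-injective : ∀ i j → encodeℤ i ≡ encodeℤ j → i ≡ j
encodeℤ-injective (+ℤ m)    (+ℤ n)    eq = cong +ℤ_ (proj₂ (pair-injective 0 m 0 n eq))
encodeℤ-injective (+ℤ m)    -[1+ n ] eq with () ← proj₁ (pair-injective 0 m 1 n eq)
encodeℤ-injective -[1+ m ] (+ℤ n)    eq with () ← proj₁ (pair-injective 1 m 0 n eq)
encodeℤ-injective -[1+ m ] -[1+ n ] eq = cong -[1+_] (proj₂ (pair-injective 1 m 1 n eq))

encodeℚ : ℚ.ℚ → ℕ
encodeℚ (ℚ.mkℚ n d _) = pair (encodeℤ n) d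

encodeℚ-injective : ∀ p q → encodeℚ p ≡ encodeℚ q → p ≡ q
encodeℚ-injective (ℚ.mkℚ n d _) (ℚ.mkℚ n′ d′ _) eq
  with eqn , refl ← pair-injective (encodeℤ n) d (encodeℤ n′) d′ eq
  with refl ← encodeℤ-injective n n′ eqn = refl

q<q+1 : ∀ q → q ℚ.< q ℚ.+ ℚ.1ℚ
q<q+1 q = subst (ℚ._< q ℚ.+ ℚ.1ℚ) (ℚ.+-identityʳ q) (ℚ.+-monoʳ-< q (ℚ.positive⁻¹ ℚ.1ℚ))

q-1<q : ∀ q → q ℚ.- ℚ.1ℚ ℚ.< q
q-1<q q = subst (q ℚ.- ℚ.1ℚ ℚ.<_) (ℚ.+-identityʳ q) (ℚ.+-monoʳ-< q (ℚ.negative⁻¹ (ℚ.- ℚ.1ℚ)))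

<1η-irrefl : ∀ {x} → ¬ x <1η x
<1η-irrefl (just<just q<q) = ℚ.<-irrefl refl q<q

<1η-connex : ∀ {x y} → ¬ x <1η y → ¬ y <1η x → x ≡ y
<1η-connex {nothing} {nothing} _ _ = refl
<1η-connex {nothing} {just q}  ≮ _ = ⊥-elim (≮ nothing<just)
<1η-connex {just p}  {nothing} _ ≯ = ⊥-elim (≯ nothing<just)
<1η-connex {just p}  {just q}  ≮ ≯ with ℚ.<-cmp p q
... | tri< p<q _ _ = ⊥-elim (≮ (just<just p<q))
... | tri≈ _ p≡q _ = cong just p≡q
... | tri> _ _ q<p = ⊥-elim (≯ (just<just q<p))

1+η : CountableRay (Maybe ℚ.ℚ)
1+η = record
  { ray = record
    { _⊏_     = _<1η_
    ; irrefl  = <1η-irrefl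
    ; transit = λ { nothing<just (just<just _) → nothing<just
                  ; (just<just p) (just<just q) → just<just (ℚ.<-trans p q) }
    ; cotrans = cotrans
    ; origin  = nothing
    ; bottom  = λ ()
    ; dense   = dense
    ; above   = λ { nothing → just ℚ.0ℚ , nothing<just ; (just q) → just (q ℚ.+ ℚ.1ℚ) , just<just (q<q+1 q) }
    }
  ; code      = code
  ; same-code = λ {x} {y} eq x<y → <1η-irrefl (subst (x <1η_) (sym (code-injective x y eq)) x<y)
  }
  where
  cotrans : ∀ {x z} y → x <1η z → x <1η y ⊎ y <1η z
  cotrans nothing  nothing<just  = inj₂ nothing<just
  cotrans nothing  (just<just _) = inj₂ nothing<just
  cotrans (just _) nothing<just  = inj₁ nothing<just
  cotrans (just q) (just<just {p} {r} p<r) with ℚ.<-cmp p q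
  ... | tri< p<q _ _  = inj₁ (just<just p<q)
  ... | tri≈ _ refl _ = inj₂ (just<just p<r)
  ... | tri> _ _ q<p  = inj₂ (just<just (ℚ.<-trans q<p p<r))
  dense : ∀ {x y} → x <1η y → ∃ λ z → x <1η z × z <1η y
  dense (nothing<just {q}) = just (q ℚ.- ℚ.1ℚ) , nothing<just , just<just (q-1<q q)
  dense (just<just p<q) with ℚ.<-dense p<q
  ... | r , p<r , r<q = just r , just<just p<r , just<just r<q
  code : Maybe ℚ.ℚ → ℕ
  code nothing  = 0
  code (just q) = suc (encodeℚ q)
  code-injective : ∀ x y → code x ≡ code y → x ≡ y
  code-injective nothing  nothing  eq = refl
  code-injective (just p) (just q) eq = cong just (encodeℚ-injective p q (suc-injective eq))

-- From countable rays to rays on the natural numbers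

module Cantor (em : ExcludedMiddle 0ℓ) where
  open BackAndForth em

  module Enumeration {M : Set} (R : CountableRay M) where
    open CountableRay R hiding (ray)

    -- Index 0 is kept for the origin, which also stands in for numbers that code nothing. Decoding
    -- the index of an element may return another member of its class.
    decode : ℕ → M
    decode zero    = origin
    decode (suc n) with em {∃ λ x → code x ≡ n}
    ... | yes (x , _) = x
    ... | no _        = origin

    index : M → ℕ
    index x = suc (code x)

    code-decode : ∀ x → code (decode (index x)) ≡ code x
    code-decode x with em {∃ λ y → code y ≡ code x}
    ... | yes (_ , eq) = eq
    ... | no none      = ⊥-elim (none (x , refl))

    decode-≮ : ∀ x → ¬ decode (index x) ⊏ x
    decode-≮ x = same-code (code-decode x)

    decode-≯ : ∀ x → ¬ x ⊏ decode (index x)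
    decode-≯ x = same-code (sym (code-decode x))

    to-index : ∀ {x} y → x ⊏ y → x ⊏ decode (index y)
    to-index y x<y with cotrans (decode (index y)) x<y
    ... | inj₁ lt = lt
    ... | inj₂ lt = ⊥-elim (decode-≮ y lt)

    from-index : ∀ {x} y → x ⊏ decode (index y) → x ⊏ y
    from-index y lt with cotrans y lt
    ... | inj₁ x<y = x<y
    ... | inj₂ gt  = ⊥-elim (decode-≯ y gt)

    index-to : ∀ {y} x → x ⊏ y → decode (index x) ⊏ y
    index-to x x<y with cotrans (decode (index x)) x<y
    ... | inj₁ gt = ⊥-elim (decode-≯ x gt)
    ... | inj₂ lt = lt

    index-from : ∀ {y} x → decode (index x) ⊏ y → x ⊏ y
    index-from x lt with cotrans x lt
    ... | inj₁ gt  = ⊥-elim (decode-≮ x gt)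
    ... | inj₂ x<y = x<y

    ray : DenseRay ℕ
    ray = record
      { _⊏_     = λ i j → decode i ⊏ decode j
      ; irrefl  = irrefl
      ; transit = transit
      ; cotrans = λ j → cotrans (decode j)
      ; origin  = zero
      ; bottom  = bottom
      ; dense   = λ lt → let z , p , q = dense lt in index z , to-index z p , index-to z q
      ; above   = λ i → let y , p = above (decode i) in index y , to-index y p
      }

  module _ {M N : Set} (A : CountableRay M) (B : CountableRay N) where
    private
      module A  = CountableRay A
      module B  = CountableRay B
      module EA = Enumeration A
      module EB = Enumeration B

      iso : Isomorphism EA.ray EB.ray
      iso = dense-rays-isomorphic EA.ray EB.ray

      g : ℕ → ℕ
      g = proj₁ iso

      mono : ∀ i j → EA.decode i A.⊏ EA.decode j ⇔ EB.decode (g i) B.⊏ EB.decode (g j)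
      mono = proj₁ (proj₂ iso)

      onto : ∀ j → ∃ λ i → ¬ EB.decode (g i) B.⊏ EB.decode j × ¬ EB.decode j B.⊏ EB.decode (g i)
      onto = proj₂ (proj₂ iso)

      f : M → N
      f = EB.decode ∘ g ∘ EA.index

    abstract
      countable-rays-isomorphic : Σ (M → N) λ f → (∀ x y → x A.⊏ y ⇔ f x B.⊏ f y) ×
                                                  (∀ y → ∃ λ x → ¬ f x B.⊏ y × ¬ y B.⊏ f x)
      countable-rays-isomorphic = f , monotone , surjective
        where
        monotone : ∀ x y → x A.⊏ y ⇔ f x B.⊏ f y
        monotone x y = mk⇔ (λ lt → to (mono (EA.index x) (EA.index y)) (EA.to-index y (EA.index-to x lt)))
                           (λ lt → EA.index-from x (EA.from-index y (from (mono (EA.index x) (EA.index y)) lt)))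
        surjective : ∀ y → ∃ λ x → ¬ f x B.⊏ y × ¬ y B.⊏ f x
        surjective y = EA.decode i , below ∘ EB.to-index y , over ∘ EB.index-to y
          where
          i k : ℕ
          i = proj₁ (onto (EB.index y))
          k = EA.index (EA.decode i)
          -- `k` may differ from `i`, but both decode into one class, so by `mono` their images are
          -- incomparable.
          below : ¬ EB.decode (g k) B.⊏ EB.decode (EB.index y)
          below lt with B.cotrans (EB.decode (g i)) lt
          ... | inj₁ p = EA.decode-≮ (EA.decode i) (from (mono k i) p)
          ... | inj₂ p = proj₁ (proj₂ (onto (EB.index y))) p
          over : ¬ EB.decode (EB.index y) B.⊏ EB.decode (g k)
          over lt with B.cotrans (EB.decode (g i)) lt
          ... | inj₁ p = proj₂ (proj₂ (onto (EB.index y))) p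
          ... | inj₂ p = EA.decode-≯ (EA.decode i) (from (mono i k) p)

-- Selection along co-c.e. cohesive sets

module AlmostEverywhere (em : ExcludedMiddle 0ℓ) (C : ℕ → Set) where
  open Classical em

  -- Classically this is `C ⊆* P`; as an implication it combines like `Eventually`.
  AE : (ℕ → Set) → Set
  AE P = Eventually (λ n → C n → P n)

  ae-map : ∀ {P Q} → (∀ n → P n → Q n) → AE P → AE Q
  ae-map f = eventually-map λ n p c → f n (p c)

  ae-zip : ∀ {P Q} → AE P → AE Q → AE (λ n → P n × Q n)
  ae-zip p q = eventually-map (λ n (p , q) c → p c , q c) (eventually-zip p q)

  ae⇒⊆* : ∀ {P} → AE P → C ⊆* P
  ae⇒⊆* (N , p) = N , λ x (c , ¬p) → ≰⇒> λ N≤x → ¬p (p x N≤x c)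

  ⊆*⇒ae : ∀ {P} → C ⊆* P → AE P
  ⊆*⇒ae (N , p) = N , λ x N≤x c → dne λ ¬p → <⇒≱ (p x (c , ¬p)) N≤x

  ¬ae⇒infinitely-often : ∀ {P} → ¬ AE P → ∀ N → ∃ λ n → N ≤ n × C n × ¬ P n
  ¬ae⇒infinitely-often ¬ae N = dne λ none → ¬ae (N , λ n N≤n c → dne λ ¬p → none (n , N≤n , c , ¬p))

  module _ (cohesive : Cohesive C) where

    ae-inhabited : ∀ {P} → AE P → ∃ λ n → C n × P n
    ae-inhabited (N , p) = dne λ none → proj₁ cohesive
      (N , λ x c → ≰⇒> λ N≤x → none (x , c , p x N≤x c))

    -- The set is the domain of a code, to which cohesiveness applies.
    dichotomy : ∀ {S : Vec ℕ 1 → Set} → Semidecider S → AE (λ n → S (n ∷ [])) ⊎ AE (λ n → ¬ S (n ∷ []))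
    dichotomy S with domain-code S
    ... | e , ⊆W , W⊆ with proj₂ cohesive e
    ...   | inj₁ fin = inj₁ (ae-map W⊆ (⊆*⇒ae fin))
    ...   | inj₂ (N , p) = inj₂ (N , λ x N≤x c s → <⇒≱ (p x (c , ⊆W x s)) N≤x)

  -- `S k x n` reads: `x` is an admissible value at `n`, of level `k`. The code picks admissible
  -- values, almost everywhere on `C`, with levels tending to infinity along `C`.
  Selection : (ℕ → ℕ → ℕ → Set) → Set
  Selection S = Σ (PR 1) λ θ →
      (∀ n x → θ ⟦ n ⟧≡ x → ∃ λ k → S k x n)
    × AE (W θ)
    × (∀ k → AE (λ n → ∀ x → θ ⟦ n ⟧≡ x → ∃ λ k′ → k ≤ k′ × S k′ x n))

  -- A number n may take the level k only while no smaller number that still seems to lie in C is seen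
  -- to have the level k.  Hence the least number of C having the level k eventually reserves it, so
  -- that each level is taken by finitely many numbers of C, while infinitely many numbers of C, those
  -- having a level not attained before, do take a level.
  abstract
    select : IsCoCE C → Cohesive C → (S : ℕ → ℕ → ℕ → Set) →
             Semidecider {3} (λ v → S (head v) (head (tail v)) (head (tail (tail v)))) →
             (∀ {k x n} → S k x n → k ≤ n) → (∀ k → ∃ λ n → C n × ∃ λ x → S k x n) → Selection S
    select (e , ¬C⊆W , W⊆¬C) cohesive S D level≤ unbounded =
      θ , sound , total (dichotomy cohesive (∃ˢ (graphˢ θ))) , tends-to-∞
      where
      module D = Semidecider D
      HasLevel : ℕ → ℕ → Set
      HasLevel k n = ∃ λ x → S k x n
      levels : Semidecider {2} (λ v → HasLevel (head v) (head (tail v)))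
      levels = ∃ˢ (D [ #1ᶜ ∷ᶜ #0ᶜ ∷ᶜ #2ᶜ ∷ᶜ []ᶜ ]ˢ)
      module Levels = Semidecider levels
      outside : Semidecider {1} (λ v → ∃ λ y → e ⟦ head v ⟧≡ y)
      outside = ∃ˢ (graphˢ e [ #0ᶜ ∷ᶜ #1ᶜ ∷ᶜ []ᶜ ]ˢ)
      module Outside = Semidecider outside
      Reserves : ℕ → ℕ → ℕ → Set
      Reserves s k m = ¬ Outside.stage (s ∷ m ∷ []) × Levels.stage (s ∷ k ∷ m ∷ [])
      Takes : Vec ℕ 4 → Set
      -- The stage must exceed `n`, so that all large `n` look late enough to see a given
      -- reservation.
      Takes v = D.stage v × suc n ≤ s × (∀ m → m < n → ¬ Reserves s (head (tail v)) m)
        where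
        s n : ℕ
        s = head v
        n = head (tail (tail (tail v)))
      takes : Decider Takes
      takes = D.decider ×ᵈ (sucᶜ #3ᶜ ≤ᵈ #0ᶜ) ×ᵈ
        ∀<ᵈ #3ᶜ (¬ᵈ ((¬ᵈ (Outside.decider [ #1ᶜ ∷ᶜ #0ᶜ ∷ᶜ []ᶜ ]ᵈ)) ×ᵈ
                     (Levels.decider [ #1ᶜ ∷ᶜ #2ᶜ ∷ᶜ #0ᶜ ∷ᶜ []ᶜ ]ᵈ)))
      uniform : Uniformizer (λ v → ∃ λ k → ∃ λ s → Takes (s ∷ k ∷ v))
      uniform = uniformize (∃ˢ (∃ˢ (decidable takes)))
      θ : PR 1
      θ = proj₁ uniform

      sound : ∀ n x → θ ⟦ n ⟧≡ x → ∃ λ k → S k x n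
      sound n x ev = let k , s , stage , _ = proj₁ (proj₂ uniform) (n ∷ []) x ev
                     in k , D.sound s (k ∷ x ∷ n ∷ []) stage

      C⇒¬outside : ∀ {s m} → C m → ¬ Outside.stage (s ∷ m ∷ [])
      C⇒¬outside {s} {m} c st = W⊆¬C m (Outside.sound s (m ∷ []) st) c

      takes-level : ∀ {n k x} → S k x n → (∀ m → m < n → ¬ (C m × HasLevel k m)) → W θ n
      takes-level {n} {k} {x} p first = proj₂ (proj₂ uniform) (n ∷ []) x (k , eventually-witness
        (eventually-zip (D.complete (k ∷ x ∷ n ∷ []) p) (eventually-zip (eventually-≥ (suc n)) (eventually-∀< n free))))
        where
        free : ∀ m → m < n → Eventually (λ s → ¬ Reserves s k m)
        free m m<n with em {C m}
        -- A smaller member of `C` lacks the level, which no stage can then show; a smaller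
        -- nonmember is eventually seen outside.
        ... | yes c = always λ s (_ , st) → first m m<n (c , Levels.sound s (k ∷ m ∷ []) st)
        ... | no ¬c = eventually-map (λ s out (¬out , _) → ¬out out) (Outside.complete (m ∷ []) (¬C⊆W m ¬c))

      total : AE (W θ) ⊎ AE (λ n → ¬ W θ n) → AE (W θ)
      total (inj₁ ae)       = ae
      -- By `level≤` a number with the level `N` is at least `N`, so the least one in `C` takes the
      -- level where `θ` was assumed undefined.
      total (inj₂ (N , ¬W)) = contradict (least (unbounded N))
        where
        contradict : (∃ λ n → (C n × HasLevel N n) × (∀ m → m < n → ¬ (C m × HasLevel N m))) → AE (W θ)
        contradict (n , (c , x , p) , first) = ⊥-elim (¬W n (level≤ p) c (takes-level p first))

      finitely-often : ∀ k → AE (λ n → ∀ x s → ¬ Takes (s ∷ k ∷ x ∷ n ∷ []))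
      finitely-often k = by-cases em
        where
        by-cases : Dec (∃ λ m → C m × HasLevel k m) → AE (λ n → ∀ x s → ¬ Takes (s ∷ k ∷ x ∷ n ∷ []))
        by-cases (no none)         = always λ n c x s t → none (n , c , x , D.sound s (k ∷ x ∷ n ∷ []) (proj₁ t))
        -- `m` belongs to `C`, so it is never seen outside; from stage `s₀` on it blocks the level
        -- for every larger number.
        by-cases (yes (m , c , l)) = suc m ⊔ s₀ , λ n le _ x s (_ , n<s , free) →
            free m (≤-trans (m≤m⊔n (suc m) s₀) le)
              (C⇒¬outside c , proj₂ reserved s (≤-trans (≤-trans (m≤n⊔m (suc m) s₀) le) (<⇒≤ n<s)))
          where
          reserved : Eventually (λ s → Levels.stage (s ∷ k ∷ m ∷ []))
          reserved = Levels.complete (k ∷ m ∷ []) l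
          s₀ : ℕ
          s₀ = proj₁ reserved

      tends-to-∞ : ∀ k → AE (λ n → ∀ x → θ ⟦ n ⟧≡ x → ∃ λ k′ → k ≤ k′ × S k′ x n)
      tends-to-∞ k = eventually-map large (eventually-∀< k λ j _ → finitely-often j)
        where
        large : ∀ n → (∀ j → j < k → C n → ∀ x s → ¬ Takes (s ∷ j ∷ x ∷ n ∷ [])) →
                C n → ∀ x → θ ⟦ n ⟧≡ x → ∃ λ k′ → k ≤ k′ × S k′ x n
        large n small c x ev = let j , s , t = proj₁ (proj₂ uniform) (n ∷ []) x ev
          in j , ≮⇒≥ (λ j<k → small j j<k c x s t) , D.sound s (j ∷ x ∷ n ∷ []) (proj₁ t)

-- Gaps in a computable order of type ω

sum<-cong : ∀ {f g} → (∀ k → f k ≡ g k) → ∀ s → sum< s f ≡ sum< s g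
sum<-cong f≗g zero    = refl
sum<-cong f≗g (suc s) = cong₂ _+_ (f≗g s) (sum<-cong f≗g s)

sum<-+ : ∀ f g s → sum< s (λ k → f k + g k) ≡ sum< s f + sum< s g
sum<-+ f g zero    = refl
sum<-+ f g (suc s) = trans (cong (f s + g s +_) (sum<-+ f g s)) (interchange +-commutativeSemigroup (f s) (g s) (sum< s f) (sum< s g))

module Rank (em : ExcludedMiddle 0ℓ) (𝓛 : CompLinOrder) (ω : OrderTypeω 𝓛) where
  open Classical em
  open CompLinOrder 𝓛 hiding (irrefl; trans; trichot)
  private module 𝓛 = CompLinOrder 𝓛

  rank : ℕ → ℕ
  rank x with em {L x}
  ... | yes l = proj₁ ω (x , l)
  ... | no  _ = 0

  -- The isomorphism takes a membership proof as argument; different values for two proofs would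
  -- give `x ≺ x`.
  rank-≡ : ∀ {x} (l : L x) → rank x ≡ proj₁ ω (x , l)
  rank-≡ {x} l with em {L x}
  ... | no ¬l = ⊥-elim (¬l l)
  ... | yes l′ with <-cmp (proj₁ ω (x , l′)) (proj₁ ω (x , l))
  ...   | tri≈ _ eq _ = eq
  ...   | tri< lt _ _ = ⊥-elim (𝓛.irrefl x l (proj₁ (proj₂ (proj₂ ω)) _ _ lt))
  ...   | tri> _ _ gt = ⊥-elim (𝓛.irrefl x l (proj₁ (proj₂ (proj₂ ω)) _ _ gt))

  rank-mono : ∀ {x y} → L x → L y → x ≺ y → rank x < rank y
  rank-mono lx ly lt = subst₂ _<_ (sym (rank-≡ lx)) (sym (rank-≡ ly)) (proj₁ (proj₂ ω) (_ , lx) (_ , ly) lt)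

  rank-cancel : ∀ {x y} → L x → L y → rank x < rank y → x ≺ y
  rank-cancel lx ly lt = proj₁ (proj₂ (proj₂ ω)) (_ , lx) (_ , ly) (subst₂ _<_ (rank-≡ lx) (rank-≡ ly) lt)

  rank-injective : ∀ {x y} → L x → L y → rank x ≡ rank y → x ≡ y
  rank-injective lx ly eq =
    proj₁ (proj₂ (proj₂ (proj₂ ω))) (_ , lx) (_ , ly) (trans (sym (rank-≡ lx)) (trans eq (rank-≡ ly)))

  abstract
    unrank : ∀ n → ∃ λ x → L x × rank x ≡ n
    unrank n with proj₂ (proj₂ (proj₂ (proj₂ ω))) n
    ... | (x , l) , eq = x , l , trans (rank-≡ l) eq

  decider-L : Decider {1} (λ v → L (head v))
  decider-L = characteristic-decider (proj₁ L-comp) λ { (x ∷ []) → proj₂ L-comp x }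

  decider-≺ : Decider {2} (λ v → head v ≺ head (tail v))
  decider-≺ = characteristic-decider (proj₁ ≺-comp) λ { (x ∷ y ∷ []) → proj₂ ≺-comp x y }

  -- Counting points in an interval of ranks

  indicator : Set → ℕ
  indicator A with em {A}
  ... | yes _ = 1
  ... | no  _ = 0

  indicator-yes : ∀ {A} → A → indicator A ≡ 1
  indicator-yes {A} a with em {A}
  ... | yes _ = refl
  ... | no ¬a = ⊥-elim (¬a a)

  indicator-no : ∀ {A} → ¬ A → indicator A ≡ 0
  indicator-no {A} ¬a with em {A}
  ... | yes a = ⊥-elim (¬a a)
  ... | no _  = refl

  count : (ℕ → Set) → ℕ → ℕ
  count P s = sum< s (indicator ∘ P)

  count-≡-before : ∀ z s → s ≤ z → count (_≡ z) s ≡ 0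
  count-≡-before z zero    le = refl
  count-≡-before z (suc s) le = cong₂ _+_ (indicator-no λ { refl → <-irrefl refl le }) (count-≡-before z s (<⇒≤ le))

  count-≡-after : ∀ z s → z < s → count (_≡ z) s ≡ 1
  count-≡-after z (suc s) z<1+s with m<1+n⇒m<n∨m≡n z<1+s
  ... | inj₁ z<s  = cong₂ _+_ (indicator-no λ { refl → <-irrefl refl z<s }) (count-≡-after z s z<s)
  ... | inj₂ refl = cong₂ _+_ (indicator-yes refl) (count-≡-before z z ≤-refl)

  -- The ranks are `a + 1` up to `a + d`, so there are exactly `d` such points.
  Ranked : ℕ → ℕ → ℕ → Set
  Ranked a d z = L z × a < rank z × rank z ≤ a + d

  -- Only the point of rank `a + suc d` is new.
  count-ranked-suc : ∀ a d s → count (Ranked a (suc d)) s ≡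
                     count (_≡ proj₁ (unrank (a + suc d))) s + count (Ranked a d) s
  count-ranked-suc a d s = trans (sum<-cong split s) (sum<-+ (indicator ∘ (_≡ t)) (indicator ∘ Ranked a d) s)
    where
    t : ℕ
    t = proj₁ (unrank (a + suc d))
    lt : L t
    lt = proj₁ (proj₂ (unrank (a + suc d)))
    rank-t : rank t ≡ a + suc d
    rank-t = proj₂ (proj₂ (unrank (a + suc d)))
    a+d<rank-t : a + d < rank t
    a+d<rank-t = subst (a + d <_) (sym rank-t) (+-monoʳ-< a ≤-refl)
    split : ∀ z → indicator (Ranked a (suc d) z) ≡ indicator (z ≡ t) + indicator (Ranked a d z)
    split z with em {z ≡ t}
    ... | yes refl = trans (indicator-yes (lt , ≤-trans (s≤s (m≤m+n a d)) a+d<rank-t , ≤-reflexive rank-t))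
                       (cong suc (sym (indicator-no λ (_ , _ , le) → <⇒≱ a+d<rank-t le)))
    ... | no z≢t with em {Ranked a d z}
    ...   | yes (lz , a< , ≤d) = indicator-yes (lz , a< , ≤-trans ≤d (+-monoʳ-≤ a (n≤1+n d)))
    ...   | no ¬r = indicator-no λ (lz , a< , ≤d) → ¬r (lz , a< ,
              s≤s⁻¹ (≤∧≢⇒< (subst (rank z ≤_) (+-suc a d) ≤d) λ eq →
                z≢t (rank-injective lz lt (trans eq (trans (sym (+-suc a d)) (sym rank-t))))))

  count-ranked-≤ : ∀ a d s → count (Ranked a d) s ≤ d
  count-ranked-≤ a zero    s = ≤-reflexive (sum<≡0 s _ λ z _ → indicator-no λ (_ , a< , ≤a) →
    <⇒≱ a< (subst (rank z ≤_) (+-identityʳ a) ≤a))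
  count-ranked-≤ a (suc d) s rewrite count-ranked-suc a d s = +-mono-≤ (count-≡-≤1 s) (count-ranked-≤ a d s)
    where
    t : ℕ
    t = proj₁ (unrank (a + suc d))
    count-≡-≤1 : ∀ s → count (_≡ t) s ≤ 1
    count-≡-≤1 s with ≤-<-connex s t
    ... | inj₁ s≤t = ≤-trans (≤-reflexive (count-≡-before t s s≤t)) z≤n
    ... | inj₂ t<s = ≤-reflexive (count-≡-after t s t<s)

  count-ranked-≥ : ∀ a d → Eventually (λ s → d ≤ count (Ranked a d) s)
  count-ranked-≥ a zero    = always λ _ → z≤n
  count-ranked-≥ a (suc d) = eventually-map
    (λ s (t<s , le) → subst (suc d ≤_) (sym (count-ranked-suc a d s))
      (+-mono-≤ (≤-reflexive (sym (count-≡-after t s t<s))) le))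
    (eventually-zip (eventually-≥ (suc t)) (count-ranked-≥ a d))
    where
    t : ℕ
    t = proj₁ (unrank (a + suc d))

  -- Semideciding the size of a gap

  -- Equivalently, at least `k` points lie strictly between `x` and `y`.
  Gap : ℕ → ℕ → ℕ → Set
  Gap k x y = L x × L y × rank x + k < rank y

  -- `rank` comes without a code, but the points strictly between `x` and `y` that are below `s` can
  -- be counted, and the count reaches its limit at some stage.
  gapˢ : Semidecider {3} (λ v → Gap (head v) (head (tail v)) (head (tail (tail v))))
  gapˢ = record
    { stage    = Stage
    ; decider  = (decider-L [ #2ᶜ ∷ᶜ []ᶜ ]ᵈ) ×ᵈ (decider-L [ #3ᶜ ∷ᶜ []ᶜ ]ᵈ) ×ᵈ
                 (decider-≺ [ #2ᶜ ∷ᶜ #3ᶜ ∷ᶜ []ᶜ ]ᵈ) ×ᵈ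
                 (#1ᶜ ≤ᵈ sum<ᶜ #0ᶜ (constᶜ 1 ∸ᶜ (Inside.computable ∘ᶜ (#0ᶜ ∷ᶜ #3ᶜ ∷ᶜ (#3ᶜ ∘ᶜ tailᶜ) ∷ᶜ []ᶜ))))
    ; sound    = λ { s (k ∷ x ∷ y ∷ []) → sound s k x y }
    ; complete = λ { (k ∷ x ∷ y ∷ []) → complete k x y }
    }
    where
    Inside : Vec ℕ 3 → Set
    Inside v = L (head v) × head (tail v) ≺ head v × head v ≺ head (tail (tail v))
    inside : Decider Inside
    inside = (decider-L [ #0ᶜ ∷ᶜ []ᶜ ]ᵈ) ×ᵈ (decider-≺ [ #1ᶜ ∷ᶜ #0ᶜ ∷ᶜ []ᶜ ]ᵈ) ×ᵈ
             (decider-≺ [ #0ᶜ ∷ᶜ #2ᶜ ∷ᶜ []ᶜ ]ᵈ)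
    module Inside = Decider inside
    seen : ℕ → ℕ → ℕ → ℕ
    -- A test succeeds with 0; `1 ∸` makes each success contribute 1 and each failure 0.
    seen s x y = sum< s (λ z → 1 ∸ Inside.test (z ∷ x ∷ y ∷ []))
    Stage : Vec ℕ 4 → Set
    Stage v = L x × L y × x ≺ y × head (tail v) ≤ seen (head v) x y
      where
      x y : ℕ
      x = head (tail (tail v))
      y = head (tail (tail (tail v)))
    seen≡count : ∀ {x y d} → L x → L y → suc (rank x) + d ≡ rank y → ∀ s → seen s x y ≡ count (Ranked (rank x) d) s
    seen≡count {x} {y} {d} lx ly eq = sum<-cong same
      where
      ranked⇒inside : ∀ {z} → Ranked (rank x) d z → Inside (z ∷ x ∷ y ∷ [])
      ranked⇒inside {z} (lz , x<z , z≤) = lz , rank-cancel lx lz x<z , rank-cancel lz ly (subst (rank z <_) eq (s≤s z≤))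
      inside⇒ranked : ∀ {z} → Inside (z ∷ x ∷ y ∷ []) → Ranked (rank x) d z
      inside⇒ranked {z} (lz , x<z , z<y) = lz , rank-mono lx lz x<z , s≤s⁻¹ (subst (rank z <_) (sym eq) (rank-mono lz ly z<y))
      same : ∀ z → 1 ∸ Inside.test (z ∷ x ∷ y ∷ []) ≡ indicator (Ranked (rank x) d z)
      same z with Inside.test (z ∷ x ∷ y ∷ []) in eq′
      ... | zero  = sym (indicator-yes (inside⇒ranked (Inside.sound _ eq′)))
      ... | suc t = trans (0∸n≡0 t) (sym (indicator-no λ r → 1+n≢0 (trans (sym eq′) (Inside.complete _ (ranked⇒inside r)))))
    sound : ∀ s k x y → Stage (s ∷ k ∷ x ∷ y ∷ []) → Gap k x y
    sound s k x y (lx , ly , x≺y , le) = lx , ly , subst (rank x + k <_) eq (s≤s (+-monoʳ-≤ (rank x)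
      (≤-trans le (≤-trans (≤-reflexive (seen≡count lx ly eq s)) (count-ranked-≤ (rank x) _ s)))))
      where
      eq : suc (rank x) + (rank y ∸ suc (rank x)) ≡ rank y
      eq = m+[n∸m]≡n (rank-mono lx ly x≺y)
    complete : ∀ k x y → Gap k x y → Eventually (λ s → Stage (s ∷ k ∷ x ∷ y ∷ []))
    complete k x y (lx , ly , gap) = eventually-map
      (λ s le → lx , ly , rank-cancel lx ly x<y ,
        ≤-trans (m+n≤o⇒m≤o∸n k (subst (_≤ rank y) (trans (cong suc (+-comm (rank x) k)) (sym (+-suc k (rank x)))) gap))
          (≤-trans le (≤-reflexive (sym (seen≡count lx ly eq s)))))
      (count-ranked-≥ (rank x) (rank y ∸ suc (rank x)))
      where
      x<y : rank x < rank y
      x<y = ≤-<-trans (m≤m+n (rank x) k) gap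
      eq : suc (rank x) + (rank y ∸ suc (rank x)) ≡ rank y
      eq = m+[n∸m]≡n x<y

-- The cohesive power

module Power (em : ExcludedMiddle 0ℓ) (𝓛 : CompLinOrder) (ω : OrderTypeω 𝓛)
             (C : ℕ → Set) (coce : IsCoCE C) (cohesive : Cohesive C) where
  open Classical em
  open BackAndForth em using (maximal)
  open Cantor em using (countable-rays-isomorphic)
  open CompLinOrder 𝓛 using (L; _≺_)
  open CohesivePower 𝓛 C
  open Condensation _≈C_ _≺C_ using (Between; FiniteSubset; _∈cF_; _<cF_) renaming (_≤_ to _≤C_)
  open AlmostEverywhere em C
  open Rank em 𝓛 ω

  -- The default 0 is met at finitely many members of `C`. The order of the power becomes almost
  -- everywhere comparison of these functions.
  ρ : Elem → ℕ → ℕ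
  ρ φ n with em {W (code φ) n}
  ... | yes (v , _) = rank v
  ... | no _        = 0

  ρ-≡ : ∀ φ {n v} → code φ ⟦ n ⟧≡ v → ρ φ n ≡ rank v
  ρ-≡ φ {n} {v} ev with em {W (code φ) n}
  ... | yes (_ , ev′) = cong rank (eval-deterministic ev′ ev)
  ... | no none       = ⊥-elim (none (v , ev))

  _<ₐ_ _≤ₐ_ _≡ₐ_ : Elem → Elem → Set
  φ <ₐ ψ = AE (λ n → ρ φ n < ρ ψ n)
  φ ≤ₐ ψ = AE (λ n → ρ φ n ≤ ρ ψ n)
  φ ≡ₐ ψ = AE (λ n → ρ φ n ≡ ρ ψ n)

  defined : ∀ φ → AE (W (code φ))
  defined φ = ⊆*⇒ae (cdom φ)

  impossible : ∀ {P} → (∀ n → ¬ P n) → ¬ AE P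
  impossible ¬p ae with ae-inhabited cohesive ae
  ... | n , _ , p = ¬p n p

  ≺C⇒<ₐ : ∀ {φ ψ} → φ ≺C ψ → φ <ₐ ψ
  ≺C⇒<ₐ {φ} {ψ} lt = ae-map (λ { n (v , w , e , e′ , v≺w) →
    subst₂ _<_ (sym (ρ-≡ φ e)) (sym (ρ-≡ ψ e′)) (rank-mono (into φ n v e) (into ψ n w e′) v≺w) }) (⊆*⇒ae lt)

  <ₐ⇒≺C : ∀ {φ ψ} → φ <ₐ ψ → φ ≺C ψ
  <ₐ⇒≺C {φ} {ψ} lt = ae⇒⊆* (ae-map (λ { n (ρ< , (v , e) , (w , e′)) → v , w , e , e′ ,
    rank-cancel (into φ n v e) (into ψ n w e′) (subst₂ _<_ (ρ-≡ φ e) (ρ-≡ ψ e′) ρ<) })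
    (ae-zip lt (ae-zip (defined φ) (defined ψ))))

  ≈C⇒≡ₐ : ∀ {φ ψ} → φ ≈C ψ → φ ≡ₐ ψ
  ≈C⇒≡ₐ {φ} {ψ} eq = ae-map (λ { n (v , e , e′) → trans (ρ-≡ φ e) (sym (ρ-≡ ψ e′)) }) (⊆*⇒ae eq)

  ≡ₐ⇒≈C : ∀ {φ ψ} → φ ≡ₐ ψ → φ ≈C ψ
  ≡ₐ⇒≈C {φ} {ψ} eq = ae⇒⊆* (ae-map (λ { n (ρ≡ , (v , e) , (w , e′)) → v , e ,
    subst (code ψ ⟦ n ⟧≡_) (sym (rank-injective (into φ n v e) (into ψ n w e′)
      (trans (sym (ρ-≡ φ e)) (trans ρ≡ (ρ-≡ ψ e′))))) e′ })
    (ae-zip eq (ae-zip (defined φ) (defined ψ))))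

  ≤C⇒≤ₐ : ∀ {φ ψ} → φ ≤C ψ → φ ≤ₐ ψ
  ≤C⇒≤ₐ (inj₁ lt) = ae-map (λ _ → <⇒≤) (≺C⇒<ₐ lt)
  ≤C⇒≤ₐ (inj₂ eq) = ae-map (λ _ → ≤-reflexive) (≈C⇒≡ₐ eq)

  lessˢ : ∀ φ ψ → Semidecider {1} (λ v → ∃ λ a → ∃ λ b →
            code φ ⟦ head v ⟧≡ a × code ψ ⟦ head v ⟧≡ b × a ≺ b)
  lessˢ φ ψ = ∃ˢ (∃ˢ ((graphˢ (code φ) [ #1ᶜ ∷ᶜ #2ᶜ ∷ᶜ []ᶜ ]ˢ) ×ˢ (graphˢ (code ψ) [ #0ᶜ ∷ᶜ #2ᶜ ∷ᶜ []ᶜ ]ˢ) ×ˢ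
                      decidable (decider-≺ [ #1ᶜ ∷ᶜ #0ᶜ ∷ᶜ []ᶜ ]ᵈ)))

  -- That the values stand in `≺` is semidecidable, so cohesiveness settles it almost everywhere; as
  -- both values exist almost everywhere, failure gives the reverse weak inequality.
  <ₐ-or-≥ₐ : ∀ φ ψ → φ <ₐ ψ ⊎ ψ ≤ₐ φ
  <ₐ-or-≥ₐ φ ψ with dichotomy cohesive (lessˢ φ ψ)
  ... | inj₁ lt = inj₁ (≺C⇒<ₐ (ae⇒⊆* lt))
  ... | inj₂ ≮  = inj₂ (ae-map (λ { n (¬lt , (v , e) , (w , e′)) → ≮⇒≥ λ ρ< → ¬lt (v , w , e , e′ ,
      rank-cancel (into φ n v e) (into ψ n w e′) (subst₂ _<_ (ρ-≡ φ e) (ρ-≡ ψ e′) ρ<)) })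
      (ae-zip ≮ (ae-zip (defined φ) (defined ψ))))

  compare : ∀ φ ψ → φ <ₐ ψ ⊎ φ ≡ₐ ψ ⊎ ψ <ₐ φ
  compare φ ψ with <ₐ-or-≥ₐ φ ψ | <ₐ-or-≥ₐ ψ φ
  ... | inj₁ lt | _       = inj₁ lt
  ... | inj₂ _  | inj₁ gt = inj₂ (inj₂ gt)
  ... | inj₂ ge | inj₂ le = inj₂ (inj₁ (ae-map (λ _ (le , ge) → ≤-antisym le ge) (ae-zip le ge)))

  -- Nearness and the order of the classes

  Within : ℕ → Elem → Elem → Set
  Within k φ ψ = AE (λ n → ρ φ n ≤ ρ ψ n + k)

  Near : Elem → Elem → Set
  Near φ ψ = ∃ λ k → Within k φ ψ × Within k ψ φ

  near-sym : ∀ {φ ψ} → Near φ ψ → Near ψ φ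
  near-sym (k , p , q) = k , q , p

  within-trans : ∀ {φ ψ χ} j k → Within j φ ψ → Within k ψ χ → Within (k + j) φ χ
  within-trans {φ} {ψ} {χ} j k p q = ae-map (λ n (p , q) → ≤-trans p (≤-trans (+-monoˡ-≤ j q)
    (≤-reflexive (+-assoc (ρ χ n) k j)))) (ae-zip p q)

  near-trans : ∀ {φ ψ χ} → Near φ ψ → Near ψ χ → Near φ χ
  near-trans {φ} {ψ} {χ} (j , p , p′) (k , q , q′) = k + j , within-trans {φ} {ψ} {χ} j k p q ,
    subst (λ m → Within m χ φ) (+-comm j k) (within-trans {χ} {ψ} {φ} k j q′ p′)

  ≤ₐ⇒within : ∀ {φ ψ} k → φ ≤ₐ ψ → Within k φ ψ
  ≤ₐ⇒within {φ} {ψ} k = ae-map λ n le → ≤-trans le (m≤m+n (ρ ψ n) k)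

  ≡ₐ⇒near : ∀ {φ ψ} → φ ≡ₐ ψ → Near φ ψ
  ≡ₐ⇒near {φ} {ψ} eq = 0 , ≤ₐ⇒within {φ} {ψ} 0 (ae-map (λ _ → ≤-reflexive) eq) ,
                           ≤ₐ⇒within {ψ} {φ} 0 (ae-map (λ _ → ≤-reflexive ∘ sym) eq)

  near-refl : ∀ {φ} → Near φ φ
  near-refl {φ} = ≡ₐ⇒near {φ} {φ} (always λ _ _ → refl)

  near-convex : ∀ {φ ψ χ} → φ <ₐ ψ → ψ <ₐ χ → Near φ χ → Near φ ψ
  near-convex {φ} {ψ} p q (k , _ , r) = k , ≤ₐ⇒within {φ} {ψ} k (ae-map (λ _ → <⇒≤) p) ,
    ae-map (λ _ (q , r) → ≤-trans (<⇒≤ q) r) (ae-zip q r)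

  <ₐ-trans : ∀ {φ ψ χ} → φ <ₐ ψ → ψ <ₐ χ → φ <ₐ χ
  <ₐ-trans p q = ae-map (λ _ → uncurry <-trans) (ae-zip p q)

  _≪_ : Elem → Elem → Set
  φ ≪ ψ = φ <ₐ ψ × ¬ Near φ ψ

  ≪-irrefl : ∀ {φ} → ¬ φ ≪ φ
  ≪-irrefl {φ} (_ , far) = far (near-refl {φ})

  ≪-trans : ∀ {φ ψ χ} → φ ≪ ψ → ψ ≪ χ → φ ≪ χ
  ≪-trans {φ} {ψ} {χ} (p , far) (q , _) =
    <ₐ-trans {φ} {ψ} {χ} p q , λ near → far (near-convex {φ} {ψ} {χ} p q near)

  far⇒≪ : ∀ φ ψ → ¬ Near φ ψ → φ ≪ ψ ⊎ ψ ≪ φ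
  far⇒≪ φ ψ far with compare φ ψ
  ... | inj₁ lt        = inj₁ (lt , far)
  ... | inj₂ (inj₁ eq) = ⊥-elim (far (≡ₐ⇒near {φ} {ψ} eq))
  ... | inj₂ (inj₂ gt) = inj₂ (gt , far ∘ near-sym {ψ} {φ})

  -- Were `χ` far below `φ`, then `φ` would lie between the near elements `χ` and `ψ`, hence be near
  -- both.
  ≪-near : ∀ {φ ψ χ} → φ ≪ ψ → Near ψ χ → φ ≪ χ
  ≪-near {φ} {ψ} {χ} (p , far) near with far⇒≪ φ χ (λ n → far (near-trans {φ} {χ} {ψ} n (near-sym {ψ} {χ} near)))
  ... | inj₁ lt      = lt
  ... | inj₂ (q , _) = ⊥-elim (far (near-sym {ψ} {φ} (near-trans {ψ} {χ} {φ} near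
                         (near-convex {χ} {φ} {ψ} q p (near-sym {ψ} {χ} near)))))

  ≪-cotrans : ∀ {φ χ} ψ → φ ≪ χ → φ ≪ ψ ⊎ ψ ≪ χ
  ≪-cotrans {φ} {χ} ψ φ≪χ with em {Near ψ χ}
  ... | yes near = inj₁ (≪-near {φ} {χ} {ψ} φ≪χ (near-sym {ψ} {χ} near))
  ... | no far with far⇒≪ ψ χ far
  ...   | inj₁ lt = inj₂ lt
  ...   | inj₂ gt = inj₁ (≪-trans {φ} {χ} {ψ} φ≪χ gt)

  -- An almost everywhere bound `k` and an almost everywhere gap above `k` would meet at a member of
  -- `C`.
  unbounded⇒≪ : ∀ {φ ψ} → (∀ k → AE (λ n → ρ φ n + k < ρ ψ n)) → φ ≪ ψ
  unbounded⇒≪ {φ} {ψ} gap = ae-map (λ n → subst (_< ρ ψ n) (+-identityʳ (ρ φ n))) (gap 0) ,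
    λ (k , _ , le) → impossible (λ _ → uncurry <⇒≱) (ae-zip (gap k) le)

  -- New elements by selection: above a class and between two classes

  element : ∀ {S} → (∀ {k x n} → S k x n → L x) → Selection S → Elem
  element inL (θ , sound , total , _) = record
    { code = θ
    ; into = λ n x ev → inL (proj₂ (sound n x ev))
    ; cdom = ae⇒⊆* total
    }

  -- Almost every value on `C` has a level at least `k`, so what follows from such a level holds
  -- almost everywhere.
  element-ae : ∀ {S} (inL : ∀ {k x n} → S k x n → L x) (θ : Selection S) k {P : ℕ → Set} →
               (∀ {j x n} → k ≤ j → S j x n → ρ (element inL θ) n ≡ rank x → P n) → AE P
  element-ae inL θ@(_ , _ , total , large) k p = ae-map
    (λ { n ((x , ev) , l) → let j , k≤j , s = l x ev in p k≤j s (ρ-≡ (element inL θ) ev) })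
    (ae-zip total (large k))

  abstract
    above : ∀ φ → ∃ λ ψ → φ ≪ ψ
    above φ = element inL θ , unbounded⇒≪ {φ} {element inL θ} λ k → element-ae inL θ k
      λ { {j} k≤j (_ , v , ev , _ , _ , gap) eq →
          subst₂ (λ a b → a + k < b) (sym (ρ-≡ φ ev)) (sym eq) (≤-<-trans (+-monoʳ-≤ (rank v) k≤j) gap) }
      where
      S : ℕ → ℕ → ℕ → Set
      -- Every gap length is available wherever `φ` is defined, so `k ≤ n` is imposed to meet the
      -- bound on levels in `select`.
      S k x n = k ≤ n × ∃ λ v → code φ ⟦ n ⟧≡ v × Gap k v x
      inL : ∀ {k x n} → S k x n → L x
      inL (_ , _ , _ , _ , l , _) = l
      unbounded : ∀ k → ∃ λ n → C n × ∃ λ x → S k x n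
      unbounded k with ae-inhabited cohesive (ae-zip (defined φ) (k , λ n k≤n _ → k≤n))
      ... | n , c , (v , ev) , k≤n with unrank (rank v + suc k)
      ...   | x , l , eq = n , c , x , k≤n , v , ev , into φ n v ev , l ,
                           subst (rank v + k <_) (sym eq) (+-monoʳ-< (rank v) ≤-refl)
      θ : Selection S
      θ = select coce cohesive S
        (decidable (#0ᶜ ≤ᵈ #2ᶜ) ×ˢ
         ∃ˢ ((graphˢ (code φ) [ #0ᶜ ∷ᶜ #3ᶜ ∷ᶜ []ᶜ ]ˢ) ×ˢ (gapˢ [ #1ᶜ ∷ᶜ #0ᶜ ∷ᶜ #2ᶜ ∷ᶜ []ᶜ ]ˢ)))
        proj₁ unbounded

    -- Level `k` asks for at least `k` points on either side. Farness makes every level occur on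
    -- `C`, as `select` requires.
    dense : ∀ {φ ψ} → φ ≪ ψ → ∃ λ χ → φ ≪ χ × χ ≪ ψ
    dense {φ} {ψ} (lt , far) = χ ,
      unbounded⇒≪ {φ} {χ} (λ k → element-ae inL θ k
        λ { (k≤j) (_ , v , _ , ev , _ , (_ , _ , gap) , _) eq →
            subst₂ (λ a b → a + k < b) (sym (ρ-≡ φ ev)) (sym eq) (≤-<-trans (+-monoʳ-≤ (rank v) k≤j) gap) }) ,
      unbounded⇒≪ {χ} {ψ} (λ k → element-ae inL θ k
        λ { {x = x} (k≤j) (_ , _ , _ , _ , ev , _ , (_ , _ , gap)) eq →
            subst₂ (λ a b → a + k < b) (sym eq) (sym (ρ-≡ ψ ev)) (≤-<-trans (+-monoʳ-≤ (rank x) k≤j) gap) })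
      where
      S : ℕ → ℕ → ℕ → Set
      S k x n = k ≤ n × ∃ λ v → ∃ λ w → code φ ⟦ n ⟧≡ v × code ψ ⟦ n ⟧≡ w × Gap k v x × Gap k x w
      inL : ∀ {k x n} → S k x n → L x
      inL (_ , _ , _ , _ , _ , (_ , l , _) , _) = l
      unbounded : ∀ k → ∃ λ n → C n × ∃ λ x → S k x n
      unbounded k with ae-zip lt (ae-zip (defined φ) (defined ψ))
      -- A distance above `2k + 2` leaves room: the point of rank `rank v + k + 1` has `k` points
      -- between `v` and itself, and at least `k` before `w`. Starting from `N ⊔ k` secures `k ≤ n`
      -- and the almost everywhere facts.
      ... | N , p with ¬ae⇒infinitely-often (λ within → far (suc k + suc k ,
                         ≤ₐ⇒within {φ} {ψ} (suc k + suc k) (ae-map (λ _ → <⇒≤) lt) , within)) (N ⊔ k)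
      ...   | n , N⊔k≤n , c , ≰ with p n (≤-trans (m≤m⊔n N k) N⊔k≤n) c
      ...     | _ , (v , ev) , (w , ev′) with unrank (rank v + suc k)
      ...       | x , l , eq = n , c , x , ≤-trans (m≤n⊔m N k) N⊔k≤n , v , w , ev , ev′ ,
        (into φ n v ev , l , subst (rank v + k <_) (sym eq) (+-monoʳ-< (rank v) ≤-refl)) ,
        (l , into ψ n w ev′ , ≤-<-trans x+k≤ (subst₂ (λ a b → a + (suc k + suc k) < b) (ρ-≡ φ ev) (ρ-≡ ψ ev′) (≰⇒> ≰)))
        where
        x+k≤ : rank x + k ≤ rank v + (suc k + suc k)
        x+k≤ = ≤-trans (≤-reflexive (trans (cong (_+ k) eq) (+-assoc (rank v) (suc k) k)))
                 (+-monoʳ-≤ (rank v) (+-monoʳ-≤ (suc k) (n≤1+n k)))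
      θ : Selection S
      θ = select coce cohesive S
        (decidable (#0ᶜ ≤ᵈ #2ᶜ) ×ˢ
         ∃ˢ (∃ˢ ((graphˢ (code φ) [ #1ᶜ ∷ᶜ #4ᶜ ∷ᶜ []ᶜ ]ˢ) ×ˢ (graphˢ (code ψ) [ #0ᶜ ∷ᶜ #4ᶜ ∷ᶜ []ᶜ ]ˢ) ×ˢ
                 (gapˢ [ #2ᶜ ∷ᶜ #1ᶜ ∷ᶜ #3ᶜ ∷ᶜ []ᶜ ]ˢ) ×ˢ (gapˢ [ #2ᶜ ∷ᶜ #3ᶜ ∷ᶜ #0ᶜ ∷ᶜ []ᶜ ]ˢ))))
        proj₁ unbounded
        where
        #4ᶜ : ∀ {n} → Computable {suc (suc (suc (suc (suc n))))} (head ∘ tail ∘ tail ∘ tail ∘ tail)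
        #4ᶜ = #3ᶜ ∘ᶜ tailᶜ
      χ : Elem
      χ = element inL θ

  -- The least class and countability of the power

  minimum : Elem
  minimum = record
    { code = proj₁ min
    ; into = λ n y ev → subst L (eval-deterministic (proj₂ min (n ∷ [])) ev) (proj₁ (proj₂ (unrank 0)))
    ; cdom = 0 , λ n (_ , ¬W) → ⊥-elim (¬W (_ , proj₂ min (n ∷ [])))
    }
    where
    min : Computable {1} (λ _ → proj₁ (unrank 0))
    min = constᶜ (proj₁ (unrank 0))

  minimum-least : ∀ {φ} → ¬ φ ≪ minimum
  minimum-least {φ} (lt , _) = impossible
    (λ { n (ρ< , _ , ev) → n≮0 (subst (ρ φ n <_) (trans (ρ-≡ minimum ev) (trans (cong rank (value ev)) (proj₂ (proj₂ (unrank 0))))) ρ<) })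
    (ae-zip lt (defined minimum))
    where
    value : ∀ {n y} → code minimum ⟦ n ⟧≡ y → y ≡ proj₁ (unrank 0)
    value {n} ev = eval-deterministic ev (proj₂ (constᶜ (proj₁ (unrank 0))) (n ∷ []))

  same-code⇒≡ₐ : ∀ {φ ψ} → code φ ≡ code ψ → φ ≡ₐ ψ
  same-code⇒≡ₐ {φ} {ψ} eq = ae-map
    (λ { n (v , ev) → trans (ρ-≡ φ ev) (sym (ρ-≡ ψ (subst (λ e → e ⟦ n ⟧≡ v) eq ev))) }) (defined φ)

  -- Countability holds because the code of an element determines it up to almost everywhere
  -- equality.
  power-ray : CountableRay Elem
  power-ray = record
    { ray = record
      { _⊏_     = _≪_
      ; irrefl  = λ {φ} → ≪-irrefl {φ}
      ; transit = λ {φ} {ψ} {χ} → ≪-trans {φ} {ψ} {χ}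
      ; cotrans = λ {φ} {χ} → ≪-cotrans {φ} {χ}
      ; origin  = minimum
      ; bottom  = λ {φ} → minimum-least {φ}
      ; dense   = λ {φ} {ψ} → dense {φ} {ψ}
      ; above   = above
      }
    ; code      = encode ∘ code
    ; same-code = λ {φ} {ψ} eq (_ , far) →
        far (≡ₐ⇒near {φ} {ψ} (same-code⇒≡ₐ {φ} {ψ} (encode-injective (code φ) (code ψ) eq)))
    }

  -- Finite intervals and condensation classes

  abstract
    -- A point strictly between uses up at least one rank on either side, so both halves have bound
    -- `k`; without such a point the endpoints are a cover.
    within⇒interval-finite : ∀ k φ ψ → Within k ψ φ → FiniteSubset (λ χ → φ ≤ₐ χ × χ ≤ₐ ψ)
    within⇒interval-finite zero φ ψ within = φ ∷ [] , λ χ (p , q) → here (≡ₐ⇒≈C {χ} {φ}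
      (ae-map (λ n (p , q , r) → ≤-antisym (≤-trans q (subst (ρ ψ n ≤_) (+-identityʳ (ρ φ n)) r)) p)
        (ae-zip p (ae-zip q within))))
    within⇒interval-finite (suc k) φ ψ within with em {∃ λ χ → φ <ₐ χ × χ <ₐ ψ}
    ... | no none = φ ∷ ψ ∷ [] , λ χ (p , q) → endpoint χ p q (<ₐ-or-≥ₐ φ χ) (<ₐ-or-≥ₐ χ ψ)
      where
      endpoint : ∀ χ → φ ≤ₐ χ → χ ≤ₐ ψ → φ <ₐ χ ⊎ χ ≤ₐ φ → χ <ₐ ψ ⊎ ψ ≤ₐ χ → Any (χ ≈C_) (φ ∷ ψ ∷ [])
      endpoint χ p q (inj₁ lt) (inj₁ lt′) = ⊥-elim (none (χ , lt , lt′))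
      endpoint χ p q (inj₂ ge) _ = here (≡ₐ⇒≈C {χ} {φ} (ae-map (λ _ → uncurry ≤-antisym) (ae-zip ge p)))
      endpoint χ p q _ (inj₂ ge) = there (here (≡ₐ⇒≈C {χ} {ψ} (ae-map (λ _ → uncurry ≤-antisym) (ae-zip q ge))))
    ... | yes (χ , φ<χ , χ<ψ)
      with within⇒interval-finite k φ χ (ae-map (λ n (lt , le) →
             s≤s⁻¹ (subst (ρ χ n <_) (+-suc (ρ φ n) k) (<-≤-trans lt le))) (ae-zip χ<ψ within))
         | within⇒interval-finite k χ ψ (ae-map (λ n (lt , le) →
             ≤-trans (subst (ρ ψ n ≤_) (+-suc (ρ φ n) k) le) (+-monoˡ-≤ k lt)) (ae-zip φ<χ within))
    ...   | xs , below | ys , over = xs ++ ys , λ υ (p , q) → split υ p q (<ₐ-or-≥ₐ υ χ)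
      where
      split : ∀ υ → φ ≤ₐ υ → υ ≤ₐ ψ → υ <ₐ χ ⊎ χ ≤ₐ υ → Any (υ ≈C_) (xs ++ ys)
      split υ p q (inj₁ lt) = ++⁺ˡ (below υ (p , ae-map (λ _ → <⇒≤) lt))
      split υ p q (inj₂ ge) = ++⁺ʳ xs (over υ (ge , q))

  near⇒∈cF : ∀ {φ ψ} → Near φ ψ → ψ ∈cF φ
  near⇒∈cF {φ} {ψ} (k , p , q) = proj₁ up ++ proj₁ down , covers
    where
    up : FiniteSubset (λ χ → φ ≤ₐ χ × χ ≤ₐ ψ)
    up = within⇒interval-finite k φ ψ q
    down : FiniteSubset (λ χ → ψ ≤ₐ χ × χ ≤ₐ φ)
    down = within⇒interval-finite k ψ φ p
    covers : ∀ χ → Between φ ψ χ → Any (χ ≈C_) (proj₁ up ++ proj₁ down)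
    covers χ (inj₁ (φ≤χ , χ≤ψ)) = ++⁺ˡ (proj₂ up χ (≤C⇒≤ₐ {φ} {χ} φ≤χ , ≤C⇒≤ₐ {χ} {ψ} χ≤ψ))
    covers χ (inj₂ (ψ≤χ , χ≤φ)) = ++⁺ʳ (proj₁ up) (proj₂ down χ (≤C⇒≤ₐ {ψ} {χ} ψ≤χ , ≤C⇒≤ₐ {χ} {φ} χ≤φ))

  -- A finite cover of the interval would contain a ≪-minimal point far above φ; density refutes it.
  ≪⇒interval-infinite : ∀ {φ ψ} → φ ≪ ψ → ¬ FiniteSubset (λ χ → φ ≤C χ × χ ≤C ψ)
  ≪⇒interval-infinite {φ} {ψ} φ≪ψ (xs , covers) = refute
    (maximal (λ χ υ → υ ≪ χ) (λ {χ} → ≪-irrefl {χ}) (λ {χ} {υ} {τ} p q → ≪-trans {τ} {υ} {χ} q p)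
      -- `ψ` joins the cover so that the list has a point far above `φ`.
      FarAbove (ψ ∷ xs) (ψ , here refl , φ≪ψ , always λ _ _ → ≤-refl))
    where
    FarAbove : Elem → Set
    FarAbove χ = φ ≪ χ × χ ≤ₐ ψ
    -- The cover meets `χ` only up to `≈C`, so its properties are carried over to the listed `υ`.
    smaller : ∀ {χ υ μ} → φ ≪ χ → χ ≪ μ → μ ≤ₐ ψ → χ ≡ₐ υ → FarAbove υ × υ ≪ μ
    smaller {χ} {υ} {μ} φ≪χ χ≪μ μ≤ψ χ≡υ =
      (≪-near {φ} {χ} {υ} φ≪χ (≡ₐ⇒near {χ} {υ} χ≡υ) ,
       ae-map (λ _ (lt , le) → ≤-trans (<⇒≤ lt) le) (ae-zip (proj₁ υ≪μ) μ≤ψ)) , υ≪μ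
      where
      υ≪μ : υ ≪ μ
      υ≪μ with ≪-cotrans {χ} {μ} υ χ≪μ
      ... | inj₁ (_ , far) = ⊥-elim (far (≡ₐ⇒near {χ} {υ} χ≡υ))
      ... | inj₂ lt        = lt
    refute : ¬ ∃ λ μ → μ ∈ ψ ∷ xs × FarAbove μ × (∀ υ → υ ∈ ψ ∷ xs → FarAbove υ → ¬ υ ≪ μ)
    refute (μ , _ , (φ≪μ , μ≤ψ) , minimal) =
      let χ , φ≪χ , χ≪μ = dense {φ} {μ} φ≪μ
          υ , υ∈xs , χ≈υ = find (covers χ (inj₁ (<ₐ⇒≺C {φ} {χ} (proj₁ φ≪χ)) ,
            inj₁ (<ₐ⇒≺C {χ} {ψ} (ae-map (λ _ → uncurry <-≤-trans) (ae-zip (proj₁ χ≪μ) μ≤ψ)))))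
          above-υ , υ≪μ = smaller {χ} {υ} {μ} φ≪χ χ≪μ μ≤ψ (≈C⇒≡ₐ {χ} {υ} χ≈υ)
      in minimal υ (there υ∈xs) above-υ υ≪μ

  ∈cF⇒near : ∀ {φ ψ} → ψ ∈cF φ → Near φ ψ
  ∈cF⇒near {φ} {ψ} (xs , covers) = dne λ far → refute (far⇒≪ φ ψ far)
    where
    refute : ¬ (φ ≪ ψ ⊎ ψ ≪ φ)
    refute (inj₁ lt) = ≪⇒interval-infinite {φ} {ψ} lt (xs , λ χ → covers χ ∘ inj₁)
    refute (inj₂ gt) = ≪⇒interval-infinite {ψ} {φ} gt (xs , λ χ → covers χ ∘ inj₂)

  <cF⇒≪ : ∀ {φ ψ} → φ <cF ψ → φ ≪ ψ
  <cF⇒≪ {φ} {ψ} lt = ≺C⇒<ₐ {φ} {ψ} (lt φ ψ (near⇒∈cF {φ} {φ} (near-refl {φ})) (near⇒∈cF {ψ} {ψ} (near-refl {ψ}))) ,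
    -- If the two were near, `ψ` would lie in both classes and be below itself.
    λ near → impossible (λ _ → <-irrefl refl) (≺C⇒<ₐ {ψ} {ψ} (lt ψ ψ (near⇒∈cF {φ} {ψ} near) (near⇒∈cF {ψ} {ψ} (near-refl {ψ}))))

  ≪⇒<cF : ∀ {φ ψ} → φ ≪ ψ → φ <cF ψ
  ≪⇒<cF {φ} {ψ} φ≪ψ α β α∈ β∈ with ≪-cotrans {φ} {ψ} α φ≪ψ
  ... | inj₁ (_ , far) = ⊥-elim (far (∈cF⇒near {φ} {α} α∈))
  ... | inj₂ α≪ψ       = <ₐ⇒≺C {α} {β} (proj₁ (≪-near {α} {ψ} {β} α≪ψ (∈cF⇒near {ψ} {β} β∈)))

  -- The order type of the condensation

  -- Elements are near exactly when they are incomparable under `≪`, and incomparable points of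
  -- `1 + η` are equal; so the map on representatives is constant on classes and separates them.
  condensation-type : CondensationHasType1+η _≈C_ _≺C_
  condensation-type = f ,
    (λ φ ψ ψ∈ → let near = ∈cF⇒near {φ} {ψ} ψ∈ in
       <1η-connex (λ lt → proj₂ (from (mono φ ψ) lt) near)
                  (λ gt → proj₂ (from (mono ψ φ) gt) (near-sym {φ} {ψ} near))) ,
    (λ φ ψ eq → near⇒∈cF {φ} {ψ} (dne λ far → distinct φ ψ eq (far⇒≪ φ ψ far))) ,
    (λ φ ψ lt → to (mono φ ψ) (<cF⇒≪ {φ} {ψ} lt)) ,
    (λ φ ψ lt → ≪⇒<cF {φ} {ψ} (from (mono φ ψ) lt)) ,
    (λ q → let φ , ≮ , ≯ = onto q in φ , <1η-connex ≮ ≯)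
    where
    iso : Σ (Elem → Maybe ℚ.ℚ) λ f → (∀ φ ψ → φ ≪ ψ ⇔ f φ <1η f ψ) × (∀ q → ∃ λ φ → ¬ f φ <1η q × ¬ q <1η f φ)
    iso = countable-rays-isomorphic power-ray 1+η
    f : Elem → Maybe ℚ.ℚ
    f = proj₁ iso
    mono : ∀ φ ψ → φ ≪ ψ ⇔ f φ <1η f ψ
    mono = proj₁ (proj₂ iso)
    onto : ∀ q → ∃ λ φ → ¬ f φ <1η q × ¬ q <1η f φ
    onto = proj₂ (proj₂ iso)
    distinct : ∀ φ ψ → f φ ≡ f ψ → ¬ (φ ≪ ψ ⊎ ψ ≪ φ)
    distinct φ ψ eq (inj₁ lt) = <1η-irrefl (subst (f φ <1η_) (sym eq) (to (mono φ ψ) lt))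
    distinct φ ψ eq (inj₂ gt) = <1η-irrefl (subst (f ψ <1η_) eq (to (mono ψ φ) gt))

theorem4p4 : ExcludedMiddle 0ℓ →
    (𝓛 : CompLinOrder) → OrderTypeω 𝓛 →
    (C : ℕ → Set) → IsCoCE C → Cohesive C →
    CondensationHasType1+η (CohesivePower._≈C_ 𝓛 C) (CohesivePower._≺C_ 𝓛 C)
theorem4p4 em 𝓛 ω C coce cohesive = Power.condensation-type em 𝓛 ω C coce cohesive
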